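{- Let $X\subset\mathbb{R}$ be a known finite set with $|X|\ge 2$ and metric $|x-y|$. Under the information and atomic-event conventions stated in the context, virtual dyadic anchor exploration (defined in the context) is $84$-competitive for blind automatic online service on $X$: $\operatorname{ALG}(I)\le 84\operatorname{OPT}_{\mathrm{auto}}(I)$ for every finite input $I$, where $\operatorname{OPT}_{\mathrm{auto}}(I)$ is the clairvoyant automatic-service offline optimum.
   Context: Model. The server starts at $s_0\in X$. An input $I$ is a finite set of request occurrences; each request $q$ has an arrival time $a(q)\ge 0$ and a location $x(q)\in X$. An arrival epoch is the set of all requests sharing one arrival time. A walk $P=(v_0,\ldots,v_\ell)$ in $X$ ($\ell\ge 0$) is executed instantaneously at one time, visits its listed vertices, and has length $\operatorname{len}(P)=\sum_i |v_{i-1}-v_i|$; monotone moves list all sites in between. A schedule is a finite sequence of atomic actions with nondecreasing timestamps. At time $t$ the complete epoch arriving at $t$ is processed first; then one action at $t$ performs a finite ordered sequence of walks (components), chosen adaptively from observations made earlier, and no arrival is interleaved until the action ends. The first walk starts at $s_0$ and every later one starts where its predecessor ended. A component walk $P$ at time $t$ during which a nonempty set $B$ of pending requests is served is one service event of cost $\operatorname{len}(P)+\max_{q\in B}(t-a(q))$ (so one instantaneous sweep incurs a single maximum-delay charge); a component serving no request costs $\operatorname{len}(P)$. The cost of a schedule is the sum of these costs; every request must eventually be served. Automatic service: every pending request whose location is visited is served in that event, and a request arriving at the current server position is served immediately at zero cost. Pure repositioning is permitted and charged by its length. $\operatorname{OPT}_{\mathrm{auto}}(I)$ is the infimum of the cost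 over feasible automatic schedules knowing the full input. Blind information: at arrival, a request's existence, persistent identity and waiting clock are revealed, but not its location. Visiting (or occupying) a location reveals (and automatically serves) every pending request there, with its identity; so the algorithm knows when every announced request has been discovered. Virtual dyadic anchor exploration. Let $\delta=\min\{|x-y|:x,y\in X,\ x\ne y\}$ and $r_j=2^j\delta$ for $j\ge 0$. Maintain an anchor $s$ (initially $s_0$) at which the server is parked between actions. After each complete arrival epoch, requests located at $s$ are automatically served at zero cost and are otherwise ignored. A phase starts with the first epoch leaving unresolved identities; for each such identity, and each identity arriving later in the phase and not resolved at $s$ on arrival, a virtual ghost is created, keeping its identity and arrival time (and location once revealed) even after its real copy is served. Let $\alpha$ be the oldest arrival time of a ghost. At times $\alpha+r_j$, $j=0,1,2,\ldots$ (after processing any epoch arriving at that time), make, as one component, a closed sweep $s\to L_{r_j}\to R_{r_j}\to s$, where $L_{r_j},R_{r_j}$ are the extreme sites of $X\cap[s-r_j,s+r_j]$; all pending requests hit are automatically served in this one event and their ghosts are marked discovered. At the first such sweep after which every ghost is discovered, choose a ghost $p$ whose location is farthest from $s$, move directly from $s$ to $x(p)$ within the same compound atomic action, set $s\leftarrow x(p)$, delete all ghosts, and end the phase. -}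

module Defs where

open import Level using (0ℓ)
open import Algebra.Bundles using (CommutativeRing)
open import Algebra.Core using (Op₁; Op₂)
open import Algebra.Structures using (IsCommutativeRing)
open import Data.Fin.Base as Fin using (Fin)
import Data.Fin.Properties as Fin
import Data.List.Extrema
open import Data.List.Base
  using (List; []; _∷_; _++_; map; filter; reverse; allFin; cartesianProduct)
open import Data.List.Membership.Propositional using (_∈_)
open import Data.List.NonEmpty.Base as List⁺ using (List⁺; _∷_; _⁺++_)
open import Data.List.Relation.Unary.All using (All)
open import Data.List.Relation.Unary.Linked using (Linked)
open import Data.Maybe using (Maybe; just; nothing; Is-just)
open import Data.Nat.Base using (ℕ; suc; _^_; z<s) renaming (_≤_ to _≤ℕ_)
open import Data.Nat.Properties using (<-trans)
open import Data.Product.Base using (∃; ∃-syntax; _×_; _,_; uncurry)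
open import Data.Sum.Base using (_⊎_)
open import Function.Base using (_∘_)
open import Relation.Binary.Bundles using (DecTotalOrder)
open import Relation.Binary.Core using (Rel)
open import Relation.Binary.PropositionalEquality using (_≡_; _≢_)
open import Relation.Binary.Structures using (IsDecTotalOrder)
open import Relation.Nullary using (¬_)
open import Relation.Nullary.Decidable using (yes; no; _×-dec_; ¬?)
open import Relation.Unary using (Pred)

import Algebra.Construct.NaturalChoice.Max as Max
import Algebra.Definitions.RawMonoid as RawMonoid

record OrderedField : Set₁ where
  infix  8 -_
  infixl 7 _*_
  infixl 6 _+_ _-_
  infix  4 _≤_ _<_
  field
    ℝ       : Set
    _+_ _*_ : Op₂ ℝ
    -_      : Op₁ ℝ
    0# 1#   : ℝ
    _≤_     : Rel ℝ 0ℓ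
    isCommutativeRing : IsCommutativeRing _≡_ _+_ _*_ -_ 0# 1#
    0≢1               : 0# ≢ 1#
    inverse           : ∀ x → x ≢ 0# → ∃[ y ] x * y ≡ 1#
    isDecTotalOrder   : IsDecTotalOrder _≡_ _≤_
    +-monoʳ-≤         : ∀ z {x y} → x ≤ y → z + x ≤ z + y
    *-nonNeg          : ∀ {x y} → 0# ≤ x → 0# ≤ y → 0# ≤ x * y

  commutativeRing : CommutativeRing 0ℓ 0ℓ
  commutativeRing = record { isCommutativeRing = isCommutativeRing }

  decTotalOrder : DecTotalOrder 0ℓ 0ℓ 0ℓ
  decTotalOrder = record { isDecTotalOrder = isDecTotalOrder }

  open DecTotalOrder decTotalOrder public using (totalOrder; _≤?_; _≟_)
  open Max totalOrder public using (_⊔_)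
  open Data.List.Extrema totalOrder public using (min; max; argmin; argmax)

  _<_ : Rel ℝ 0ℓ
  x < y = x ≤ y × x ≢ y

  _-_ : Op₂ ℝ
  x - y = x + (- y)

  ∣_∣ : Op₁ ℝ
  ∣ x ∣ = x ⊔ (- x)

  fromℕ : ℕ → ℝ
  fromℕ n = n ·ℕ 1#
    where open RawMonoid (CommutativeRing.+-rawMonoid commutativeRing)
            using () renaming (_×_ to _·ℕ_)

  IsLowerBound : Pred ℝ 0ℓ → ℝ → Set
  IsLowerBound P b = ∀ x → P x → b ≤ x

  IsInfimum : Pred ℝ 0ℓ → ℝ → Set
  IsInfimum P m = IsLowerBound P m × (∀ b → IsLowerBound P b → b ≤ m)

-- The library has no type of classical real numbers, so ℝ is given by the
-- usual axioms of a Dedekind-complete ordered field, which characterise it up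
-- to isomorphism.  Decidability of the order and the Archimedean axiom are
-- classical consequences of the others; they are listed because they do not
-- follow from them constructively.
record RealNumbers : Set₁ where
  field
    orderedField : OrderedField

  open OrderedField orderedField public

  field
    archimedean : ∀ x → ∃[ n ] x ≤ fromℕ n
    complete    : (P : Pred ℝ 0ℓ) → ∃ P → ∃ (IsLowerBound P) → ∃ (IsInfimum P)

-- A finite subset of ℝ with at least two elements, presented by its
-- (unique) increasing enumeration.
record FiniteSubset (R : RealNumbers) : Set where
  open RealNumbers R using (ℝ; _<_)
  field
    size       : ℕ
    2≤size     : 2 ≤ℕ size
    point      : Fin size → ℝ
    increasing : ∀ {u v} → u Fin.< v → point u < point v

  Site : Set
  Site = Fin size

  sites : List Site
  sites = allFin _

-- Requests are identified by the elements of Fin count, so that distinct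
-- requests may share both arrival time and location.
record Input (R : RealNumbers) (X : FiniteSubset R) : Set where
  open RealNumbers R using (ℝ; 0#; _≤_)
  open FiniteSubset X using (Site)
  field
    count    : ℕ
    arrival  : Fin count → ℝ
    location : Fin count → Site
    arrival-nonNeg : ∀ q → 0# ≤ arrival q

  Request : Set
  Request = Fin count

  requests : List Request
  requests = allFin count

module Geometry (R : RealNumbers) (X : FiniteSubset R) where
  open RealNumbers R
  open FiniteSubset X

  dist : Site → Site → ℝ
  dist u v = ∣ point u - point v ∣

  -- A walk (v₀,…,v_ℓ) is represented by v₀, which is always the current
  -- position of the server, together with the list v₁,…,v_ℓ.
  len : Site → List Site → ℝ
  len u []       = 0#
  len u (v ∷ vs) = dist u v + len v vs

  end : Site → List Site → Site
  end u []       = u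
  end u (v ∷ vs) = end v vs

  -- The monotone move from u to v, without its starting site u.
  monotone : Site → Site → List Site
  monotone u v with u Fin.≤? v
  ... | yes _ = filter (λ w → u Fin.<? w ×-dec w Fin.≤? v) sites
  ... | no  _ = reverse (filter (λ w → v Fin.≤? w ×-dec w Fin.<? u) sites)

  -- The default value of the minimum is itself one of the distances.
  δ : ℝ
  δ = min (dist (Fin.fromℕ< (<-trans z<s 2≤size)) (Fin.fromℕ< 2≤size))
          (map (uncurry dist)
               (filter (λ (u , v) → ¬? (u Fin.≟ v)) (cartesianProduct sites sites)))

  radius : ℕ → ℝ
  radius j = fromℕ (2 ^ j) * δ

  window : Site → ℝ → List Site
  window s r =
    filter (λ v → (point s - r) ≤? point v ×-dec point v ≤? (point s + r)) sites

  leftmost rightmost : Site → ℝ → Site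
  leftmost  s r = argmin point s (window s r)
  rightmost s r = argmax point s (window s r)

  sweep : Site → ℝ → List Site
  sweep s r = monotone s L ++ monotone L T ++ monotone T s
    where L = leftmost s r
          T = rightmost s r

  record Action : Set where
    constructor at_perform_
    field
      time       : ℝ
      components : List (List Site)

  Schedule : Set
  Schedule = List Action

module Service (R : RealNumbers) (X : FiniteSubset R)
               (s₀ : FiniteSubset.Site X) (I : Input R X) where
  open RealNumbers R
  open FiniteSubset X
  open Geometry R X
  open Input I
  open import Data.List.Membership.DecPropositional (Fin._≟_ {count})
    using () renaming (_∈?_ to _∈ᵣ?_)
  open import Data.List.Membership.DecPropositional (Fin._≟_ {size})
    using () renaming (_∈?_ to _∈ₛ?_)

  ------------------------------------------------------------------------
  -- Automatic service

  record Server : Set where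
    constructor ⟨_,_⟩
    field
      position : Site
      served   : List Request
  open Server

  initial : Server
  initial = ⟨ s₀ , [] ⟩

  -- Zero-cost service, up to and including the epoch arriving at t, of the
  -- requests arriving at the current position.  No lower bound on the arrival
  -- time is needed: a request at the current position that arrived no later
  -- than the preceding action was served by that action.
  await : ℝ → Server → Server
  await t c = ⟨ position c , filter free? requests ++ served c ⟩
    where free? = λ q → arrival q ≤? t ×-dec location q Fin.≟ position c

  hit : ℝ → Server → List Site → List Request
  hit t c w = filter pending-and-visited? requests
    where
    pending-and-visited? = λ q →
      (arrival q ≤? t ×-dec ¬? (q ∈ᵣ? served c))
        ×-dec location q ∈ₛ? (position c ∷ w)

  walk : ℝ → Server → List Site → Server
  walk t c w = ⟨ end (position c) w , hit t c w ++ served c ⟩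

  -- The delays are nonnegative, so the default 0 of the maximum only matters
  -- when the walk serves no request.
  walkCost : ℝ → Server → List Site → ℝ
  walkCost t c w =
    len (position c) w + max 0# (map (λ q → t - arrival q) (hit t c w))

  walks : ℝ → Server → List (List Site) → Server
  walks t c []       = c
  walks t c (w ∷ ws) = walks t (walk t c w) ws

  walksCost : ℝ → Server → List (List Site) → ℝ
  walksCost t c []       = 0#
  walksCost t c (w ∷ ws) = walkCost t c w + walksCost t (walk t c w) ws

  run : Server → Schedule → Server
  run c []                   = c
  run c ((at t perform ws) ∷ S) = run (walks t (await t c) ws) S

  runCost : Server → Schedule → ℝ
  runCost c []                   = 0#
  runCost c ((at t perform ws) ∷ S) =
    walksCost t (await t c) ws + runCost (walks t (await t c) ws) S

  cost : Schedule → ℝ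
  cost = runCost initial

  -- After the last action, requests can still be served by arriving at the
  -- final position.
  Feasible : Schedule → Set
  Feasible S = Linked _≤_ (map Action.time S)
             × (∀ q → q ∈ served final ⊎ location q ≡ position final)
    where final = run initial S

  IsOPT : ℝ → Set
  IsOPT = IsInfimum (λ x → ∃[ S ] Feasible S × cost S ≡ x)

  ------------------------------------------------------------------------
  -- Virtual dyadic anchor exploration

  -- The sequence r of sweep radii is instantiated to the dyadic one below.
  module Exploration (r : ℕ → ℝ) where

    -- The location is unknown to the algorithm until a sweep reveals it.
    record Ghost : Set where
      constructor ghost
      field
        identity : Request
        revealed : Maybe Site
    open Ghost

    oldest : List⁺ Ghost → ℝ
    oldest (g ∷ gs) = min (arrival (identity g)) (map (arrival ∘ identity) gs)

    sweepTime : ℕ → List⁺ Ghost → ℝ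
    sweepTime j G = oldest G + r j

    reveal : List Site → Ghost → Ghost
    reveal vs g with location (identity g) ∈ₛ? vs
    ... | yes _ = ghost (identity g) (just (location (identity g)))
    ... | no  _ = g

    afterSweep : Site → ℕ → List⁺ Ghost → List⁺ Ghost
    afterSweep s j = List⁺.map (reveal (s ∷ sweep s (r j)))

    AllDiscovered : List⁺ Ghost → Set
    AllDiscovered G = All (Is-just ∘ revealed) (List⁺.toList G)

    _DiscoveredIn_At_ : Ghost → List⁺ Ghost → Site → Set
    g DiscoveredIn G At x = g ∈ List⁺.toList G × revealed g ≡ just x

    -- x is the location of a (discovered) ghost of G farthest from s.
    Farthest : Site → List⁺ Ghost → Site → Set
    Farthest s G x = (∃[ p ] p DiscoveredIn G At x)
                   × (∀ g y → g DiscoveredIn G At y → dist s y ≤ dist s x)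

    -- In the following, U lists the requests that have not arrived yet.

    NextEpoch : ℝ → List Request → Set
    NextEpoch t U = (∃[ q ] q ∈ U × arrival q ≡ t) × All (λ q → t ≤ arrival q) U

    later : ℝ → List Request → List Request
    later t = filter (λ q → ¬? (arrival q ≟ t))

    -- Ghosts of the requests of the epoch t that are not resolved on arrival
    -- at the anchor s.
    newGhosts : Site → ℝ → List Request → List Ghost
    newGhosts s t U = map (λ q → ghost q nothing)
      (filter (λ q → arrival q ≟ t ×-dec ¬? (location q Fin.≟ s)) U)

    data State : Set where
      idle  : (s : Site) (U : List Request) → State
      phase : (s : Site) (j : ℕ) (G : List⁺ Ghost) (U : List Request) → State

    -- σ ⇝ S: from state σ on, the algorithm may perform the actions S.  The
    -- relation is deterministic except for the choice among farthest ghosts.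
    -- In a phase, j is the index of the next sweep; an epoch arriving at the
    -- time of a sweep is processed before that sweep.
    infix 4 _⇝_
    data _⇝_ : State → Schedule → Set where

      halt : ∀ {s} → idle s [] ⇝ []

      resolved-epoch : ∀ {s t U S}
        → NextEpoch t U
        → newGhosts s t U ≡ []
        → idle s (later t U) ⇝ S
        → idle s U ⇝ S

      start-phase : ∀ {s t U g gs S}
        → NextEpoch t U
        → newGhosts s t U ≡ g ∷ gs
        → phase s 0 (g ∷ gs) (later t U) ⇝ S
        → idle s U ⇝ S

      epoch-in-phase : ∀ {s j G t U S}
        → NextEpoch t U
        → t ≤ sweepTime j G
        → phase s j (G ⁺++ newGhosts s t U) (later t U) ⇝ S
        → phase s j G U ⇝ S

      continue-phase : ∀ {s j G U S}
        → All (λ q → sweepTime j G < arrival q) U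
        → ¬ AllDiscovered (afterSweep s j G)
        → phase s (suc j) (afterSweep s j G) U ⇝ S
        → phase s j G U
            ⇝ (at sweepTime j G perform (sweep s (r j) ∷ [])) ∷ S

      end-phase : ∀ {s j G U x S}
        → All (λ q → sweepTime j G < arrival q) U
        → AllDiscovered (afterSweep s j G)
        → Farthest s (afterSweep s j G) x
        → idle x U ⇝ S
        → phase s j G U
            ⇝ (at sweepTime j G perform (sweep s (r j) ∷ monotone s x ∷ [])) ∷ S

  AnchorExploration : Schedule → Set
  AnchorExploration S = idle s₀ requests ⇝ S
    where open Exploration radius using (idle; _⇝_)

{-# OPTIONS --safe #-}

-- A phase that moves the anchor by D ends with a sweep of radius r ≤ 2D, so it
-- costs at most 10r + D ≤ 21D, the radii of the sweeps being dyadic.  It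
-- remains to see that the anchor moves at most 4·OPT in total.
--
-- Follow an arbitrary schedule through the phases, crediting the delay of a
-- request continuously while it waits; the phases occupy disjoint intervals of
-- time.  Either the schedule serves the farthest ghost p during its phase, or p
-- is still pending at the new anchor when the next phase starts.  The potential
-- is twice the distance from the server to the anchor in the first case and 0 in
-- the second: a pending p will make the server come to the anchor or wait for
-- the whole next phase, which lasts at least as long as the distance that the
-- anchor then moves.  If p stays pending, the phase is paid for by a witness q,
-- a ghost at distance at least D/2 that made the last sweep necessary and that
-- has waited at least D/2 at the end of the phase.

module Submission where

open import Defs
open import Algebra.Bundles using (CommutativeRing)
import Algebra.Construct.NaturalChoice.Max as NaturalMax
import Algebra.Properties.Ring as RingProperties
import Algebra.Properties.Semiring.Mult as Mult
import Algebra.Properties.Semiring.Mult.TCOptimised as NumeralMult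
import Algebra.Solver.Ring.NaturalCoefficients.Default as Solver
import Data.Fin.Base as Fin
import Data.Fin.Properties as Fin
open import Data.List.Base
  using (List; []; _∷_; _++_; map; filter; reverse; cartesianProduct; concat; concatMap; length)
import Data.List.Extrema
import Data.List.Membership.DecPropositional as DecMembership
open import Data.List.Membership.Propositional using (_∈_; _∉_; find; lose)
open import Data.List.Membership.Propositional.Properties
  using (∈-filter⁺; ∈-filter⁻; ∈-allFin; ∈-++⁺ˡ; ∈-++⁺ʳ; ∈-++⁻; ∈-map⁺; ∈-map⁻; ∈-cartesianProduct⁺)
open import Data.List.NonEmpty.Base as List⁺ using (List⁺; _∷_; _⁺++_)
open import Data.List.Properties using (unfold-reverse; filter-notAll)
open import Data.List.Relation.Unary.All as All using (All; []; _∷_)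
import Data.List.Relation.Unary.All.Properties as All
open import Data.List.Relation.Unary.AllPairs as AllPairs using (AllPairs; []; _∷_)
import Data.List.Relation.Unary.AllPairs.Properties as AllPairs
open import Data.List.Relation.Unary.Any using (here; there)
open import Data.List.Relation.Unary.Any.Properties using (reverse⁺; reverse⁻)
open import Data.List.Relation.Unary.Linked as Linked using (Linked; []; [-]; _∷_)
open import Data.Maybe using (just; nothing; Is-just)
open import Data.Maybe.Properties using (just-injective)
open import Data.Maybe.Relation.Unary.Any using (just)
open import Data.Nat.Base as ℕ using (ℕ; zero; suc)
import Data.Nat.Properties as ℕ
open import Data.Product.Base using (_×_; _,_; proj₁; proj₂; ∃-syntax; uncurry)
open import Data.Sum.Base using (_⊎_; inj₁; inj₂; [_,_]′)
open import Data.Unit.Base using (tt)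
open import Function.Base using (flip; _∘_; id)
open import Level using (0ℓ)
open import Relation.Binary.Bundles using (DecTotalOrder)
open import Relation.Binary.Core using (Rel)
open import Relation.Binary.Definitions using (tri<; tri≈; tri>)
open import Relation.Binary.PropositionalEquality
  using (_≡_; _≢_; refl; sym; trans; cong; cong₂; subst; subst₂)
open import Relation.Nullary using (¬_; contradiction; yes; no; ¬?; Dec; _×-dec_)
open import Relation.Nullary.Decidable using (toSum)
open import Relation.Unary using (Decidable)

-- An event is charged only the maximum of its delays, so the waits of different requests cannot be
-- added up. A phase therefore charges the schedule for its whole movement `M` and for the wait `W`
-- of one request chosen according to the case; the factor 4 has to make `D + φ′ ≤ φ + 4 (M + W)`
-- hold in every case, where `D` is the displacement of the anchor and `φ`, `φ′` are the potentials
-- before and after.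
--
-- The factor 2 in the potential matches the witness: `D` is at most twice the distance from the
-- anchor to `q`, so if the server reaches `q` from a position away from the anchor, twice that
-- offset is what its movement may fail to cover. The ghost `p` cannot replace `q` as the request
-- that waits: it may arrive just before the last sweep and have waited hardly at all when the phase
-- ends.

-- Ordered-field arithmetic and the metric of the line.

module OrderedFieldProperties (R : RealNumbers) where
  open RealNumbers R
  open CommutativeRing commutativeRing public
    using (+-assoc; +-comm; +-identityˡ; +-identityʳ; *-comm; *-assoc; *-identityˡ; zeroˡ;
           distribʳ; -‿inverseˡ; -‿inverseʳ; commutativeSemiring; semiring; ring)
  open DecTotalOrder decTotalOrder public
    using () renaming (refl to ≤-refl; trans to ≤-trans; antisym to ≤-antisym;
                       total to ≤-total; reflexive to ≤-reflexive)
  open Solver commutativeSemiring public using (Polynomial; solve; _:+_; _:*_; _:=_; con)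
  open NaturalMax totalOrder using (x≤x⊔y; x≤y⊔x; ⊔-lub)
  open Mult semiring using (×-homo-+)

  infixl 6 _+≤_
  _+≤_ : ∀ {a b c d} → a ≤ b → c ≤ d → a + c ≤ b + d
  _+≤_ {a} {b} {c} {d} a≤b c≤d = ≤-trans (+-monoʳ-≤ a c≤d)
    (subst (λ z → z ≤ b + d) (+-comm d a) (subst (λ z → d + a ≤ z) (+-comm d b) (+-monoʳ-≤ d a≤b)))

  +-cancelʳ-≤ : ∀ z {x y} → x + z ≤ y + z → x ≤ y
  +-cancelʳ-≤ z {x} {y} p = subst (x ≤_) (undo y) (subst (_≤ y + z - z) (undo x) (p +≤ ≤-refl))
    where
    undo : ∀ w → w + z - z ≡ w
    undo w = trans (+-assoc w z (- z)) (trans (cong (w +_) (-‿inverseʳ z)) (+-identityʳ w))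

  -- l ≤ h is a sum of hypotheses from which the goal differs by a summand
  -- common to both sides.
  linear : ∀ {l h x y} → l ≤ h → x + h ≡ y + l → x ≤ y
  linear {l} {h} {x} {y} l≤h eq =
    +-cancelʳ-≤ h (subst (_≤ y + h) (sym eq) (≤-refl +≤ l≤h))

  <⇒≱ : ∀ {x y} → x < y → ¬ (y ≤ x)
  <⇒≱ (x≤y , x≢y) y≤x = x≢y (≤-antisym x≤y y≤x)

  ≰⇒> : ∀ {x y} → ¬ (x ≤ y) → y < x
  ≰⇒> {x} {y} x≰y =
    [ (λ x≤y → contradiction x≤y x≰y) , (λ y≤x → y≤x) ]′ (≤-total x y) ,
    λ y≡x → x≰y (≤-reflexive (sym y≡x))

  <-≤-trans : ∀ {x y z} → x < y → y ≤ z → x < z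
  <-≤-trans x<y y≤z = ≰⇒> (λ z≤x → <⇒≱ x<y (≤-trans y≤z z≤x))

  ≤-<-trans : ∀ {x y z} → x ≤ y → y < z → x < z
  ≤-<-trans x≤y y<z = ≰⇒> (λ z≤x → <⇒≱ y<z (≤-trans z≤x x≤y))

  x-y+y : ∀ x y → x - y + y ≡ x
  x-y+y x y = trans (+-assoc x (- y) y) (trans (cong (x +_) (-‿inverseˡ y)) (+-identityʳ x))

  x≤y+z⇒x-z≤y : ∀ {x y z} → x ≤ y + z → x - z ≤ y
  x≤y+z⇒x-z≤y {x} {y} {z} p = +-cancelʳ-≤ z (subst (_≤ y + z) (sym (x-y+y x z)) p)

  x-z≤y⇒x≤y+z : ∀ {x y z} → x - z ≤ y → x ≤ y + z
  x-z≤y⇒x≤y+z {x} {y} {z} p = subst (_≤ y + z) (x-y+y x z) (p +≤ ≤-refl)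

  0≤-x : ∀ {x} → x ≤ 0# → 0# ≤ - x
  0≤-x {x} p = +-cancelʳ-≤ x
    (subst (0# + x ≤_) (sym (-‿inverseˡ x)) (subst (_≤ 0#) (sym (+-identityˡ x)) p))

  0≤1 : 0# ≤ 1#
  0≤1 with ≤-total 0# 1#
  ... | inj₁ 0≤1 = 0≤1
  ... | inj₂ 1≤0 = subst (0# ≤_) -1*-1≡1 (*-nonNeg (0≤-x 1≤0) (0≤-x 1≤0))
    where
    open RingProperties ring using (-1*x≈-x; -‿involutive)
    -1*-1≡1 : - 1# * - 1# ≡ 1#
    -1*-1≡1 = trans (-1*x≈-x (- 1#)) (-‿involutive 1#)

  0<1 : 0# < 1#
  0<1 = 0≤1 , 0≢1

  0≤x+y : ∀ {x y} → 0# ≤ x → 0# ≤ y → 0# ≤ x + y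
  0≤x+y {x} {y} p q = subst (_≤ x + y) (+-identityˡ 0#) (p +≤ q)

  x≤x+y : ∀ x {y} → 0# ≤ y → x ≤ x + y
  x≤x+y x {y} p = subst (_≤ x + y) (+-identityʳ x) (≤-refl {x} +≤ p)

  x≤y+x : ∀ x {y} → 0# ≤ y → x ≤ y + x
  x≤y+x x {y} p = subst (_≤ y + x) (+-identityˡ x) (p +≤ ≤-refl {x})

  *-monoʳ-≤ : ∀ {x y z} → 0# ≤ z → x ≤ y → x * z ≤ y * z
  *-monoʳ-≤ {x} {y} {z} 0≤z x≤y = subst (_≤ y * z) (+-identityˡ (x * z))
    (subst (0# + x * z ≤_) eq (*-nonNeg 0≤y-x 0≤z +≤ ≤-refl {x * z}))
    where
    0≤y-x : 0# ≤ y - x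
    0≤y-x = +-cancelʳ-≤ x (subst (0# + x ≤_) (sym (x-y+y y x)) (subst (_≤ y) (sym (+-identityˡ x)) x≤y))
    eq : (y - x) * z + x * z ≡ y * z
    eq = trans (sym (distribʳ z (y - x) x)) (cong (_* z) (x-y+y y x))

  fromℕ-nonNeg : ∀ n → 0# ≤ fromℕ n
  fromℕ-nonNeg zero    = ≤-refl
  fromℕ-nonNeg (suc n) = 0≤x+y 0≤1 (fromℕ-nonNeg n)

  fromℕ-homo-+ : ∀ m n → fromℕ (m ℕ.+ n) ≡ fromℕ m + fromℕ n
  fromℕ-homo-+ m n = ×-homo-+ 1# m n

  fromℕ-mono-≤ : ∀ {m n} → m ℕ.≤ n → fromℕ m ≤ fromℕ n
  fromℕ-mono-≤ {n = n} ℕ.z≤n     = fromℕ-nonNeg n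
  fromℕ-mono-≤         (ℕ.s≤s p) = ≤-refl +≤ fromℕ-mono-≤ p

  fromℕ-pos : ∀ n → 0# < fromℕ (suc n)
  fromℕ-pos n = <-≤-trans 0<1 (x≤x+y 1# (fromℕ-nonNeg n))

  positive-inverse : ∀ {c} → 0# < c → ∃[ d ] 0# ≤ d × c * d ≡ 1#
  positive-inverse {c} (0≤c , 0≢c) with inverse c (λ c≡0 → 0≢c (sym c≡0))
  ... | d , cd≡1 with ≤-total 0# d
  ...   | inj₁ 0≤d = d , 0≤d , cd≡1
  ...   | inj₂ d≤0 = contradiction
    (subst₂ _≤_ (trans (*-comm d c) cd≡1) (zeroˡ c) (*-monoʳ-≤ 0≤c d≤0)) (<⇒≱ 0<1)

  gap : ℝ → ℝ → ℝ
  gap x y = ∣ x - y ∣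

  neg-sub : ∀ x y → - (x - y) ≡ y - x
  neg-sub x y = trans (-‿anti-homo-+ x (- y)) (cong (_- x) (-‿involutive y))
    where open RingProperties ring using (-‿anti-homo-+; -‿involutive)

  ≤-gapˡ : ∀ x y → x ≤ gap x y + y
  ≤-gapˡ x y = x-z≤y⇒x≤y+z (x≤x⊔y (x - y) (- (x - y)))

  ≤-gapʳ : ∀ x y → y ≤ gap x y + x
  ≤-gapʳ x y = x-z≤y⇒x≤y+z (subst (_≤ gap x y) (neg-sub x y) (x≤y⊔x (x - y) (- (x - y))))

  gap-≤ : ∀ {x y c} → x ≤ c + y → y ≤ c + x → gap x y ≤ c
  gap-≤ {x} {y} {c} p q =
    ⊔-lub (x≤y+z⇒x-z≤y p) (subst (_≤ c) (sym (neg-sub x y)) (x≤y+z⇒x-z≤y q))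

  gap-sym-≤ : ∀ x y → gap x y ≤ gap y x
  gap-sym-≤ x y = gap-≤ (≤-gapʳ y x) (≤-gapˡ y x)

  gap-sym : ∀ x y → gap x y ≡ gap y x
  gap-sym x y = ≤-antisym (gap-sym-≤ x y) (gap-sym-≤ y x)

  gap-triangle : ∀ x y z → gap x z ≤ gap x y + gap y z
  gap-triangle x y z = gap-≤
    (linear (≤-gapˡ x y +≤ ≤-gapˡ y z)
      (solve 5 (λ x y z a b → x :+ (a :+ y :+ (b :+ z)) := a :+ b :+ z :+ (x :+ y)) refl x y z (gap x y) (gap y z)))
    (linear (≤-gapʳ x y +≤ ≤-gapʳ y z)
      (solve 5 (λ x y z a b → z :+ (a :+ x :+ (b :+ y)) := a :+ b :+ x :+ (y :+ z)) refl x y z (gap x y) (gap y z)))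

  halve : ∀ {x y} → x + x ≤ y + y → x ≤ y
  halve {x} {y} p with ≤-total x y
  ... | inj₁ x≤y = x≤y
  ... | inj₂ y≤x = linear (p +≤ y≤x)
    (solve 2 (λ x y → x :+ (y :+ y :+ x) := y :+ (x :+ x :+ y)) refl x y)

  gap-nonNeg : ∀ x y → 0# ≤ gap x y
  gap-nonNeg x y = halve (linear (≤-gapˡ x y +≤ ≤-gapʳ x y)
    (solve 3 (λ x y a → con 0 :+ con 0 :+ (a :+ y :+ (a :+ x)) := a :+ a :+ (x :+ y)) refl x y (gap x y)))

  gap-refl : ∀ x → gap x x ≡ 0#
  gap-refl x = ≤-antisym (gap-≤ (≤-reflexive (sym (+-identityˡ x))) (≤-reflexive (sym (+-identityˡ x))))
    (gap-nonNeg x x)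

  gap-pos : ∀ {x y} → x < y → 0# < gap x y
  gap-pos {x} {y} x<y = gap-nonNeg x y ,
    λ 0≡gap → <⇒≱ x<y (subst (y ≤_) (trans (cong (_+ x) (sym 0≡gap)) (+-identityˡ x)) (≤-gapʳ x y))

  x≤y⇒gap+x : ∀ {x y} → x ≤ y → gap x y + x ≡ y
  x≤y⇒gap+x {x} {y} x≤y = ≤-antisym
    (subst (gap x y + x ≤_) (x-y+y y x)
      (gap-≤ (≤-trans x≤y (x≤y+x y 0≤y-x)) (≤-reflexive (sym (x-y+y y x))) +≤ ≤-refl {x}))
    (≤-gapʳ x y)
    where
    0≤y-x : 0# ≤ y - x
    0≤y-x = +-cancelʳ-≤ x (subst (0# + x ≤_) (sym (x-y+y y x)) (subst (_≤ y) (sym (+-identityˡ x)) x≤y))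

  -- Betweenness turns the triangle inequality into an equality.
  gap-between : ∀ {x y z} → x ≤ y → y ≤ z → gap x y + gap y z ≡ gap x z
  gap-between {x} {y} {z} x≤y y≤z = ≤-antisym
    (linear (≤-reflexive (x≤y⇒gap+x x≤y) +≤ ≤-reflexive (x≤y⇒gap+x y≤z) +≤ ≤-gapʳ x z)
      (solve 6 (λ x y z a b c → a :+ b :+ (y :+ z :+ (c :+ x)) := c :+ (a :+ x :+ (b :+ y) :+ z)) refl
        x y z (gap x y) (gap y z) (gap x z)))
    (gap-triangle x y z)

AllPairs-reverse : ∀ {A : Set} {ℓ} {_~_ : Rel A ℓ} xs →
                   AllPairs _~_ xs → AllPairs (flip _~_) (reverse xs)
AllPairs-reverse []       []         = []
AllPairs-reverse (x ∷ xs) (x~xs ∷ p) = subst (AllPairs _) (sym (unfold-reverse x xs))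
  (AllPairs.++⁺ (AllPairs-reverse xs p) ([] ∷ [])
    (All.tabulate (λ w∈ → All.lookup x~xs (reverse⁻ w∈) ∷ [])))

-- Walks, monotone moves, sweeps and dyadic radii.

module GeometryProperties (R : RealNumbers) (X : FiniteSubset R) where
  open RealNumbers R
  open OrderedFieldProperties R
  open FiniteSubset X
  open Geometry R X
  open Data.List.Extrema totalOrder using
    (argmin-all; argmax-all; f[argmin]≤f[xs]; f[xs]≤f[argmax]; min≤xs; min≤⊤; v<min⁺; xs≤max)

  dist-sym : ∀ u v → dist u v ≡ dist v u
  dist-sym u v = gap-sym (point u) (point v)

  dist-refl : ∀ u → dist u u ≡ 0#
  dist-refl u = gap-refl (point u)

  dist-nonNeg : ∀ u v → 0# ≤ dist u v
  dist-nonNeg u v = gap-nonNeg (point u) (point v)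

  dist-triangle : ∀ u v w → dist u w ≤ dist u v + dist v w
  dist-triangle u v w = gap-triangle (point u) (point v) (point w)

  dist-pos : ∀ {u v} → u ≢ v → 0# < dist u v
  dist-pos {u} {v} u≢v with Fin.<-cmp u v
  ... | tri< u<v _ _ = gap-pos (increasing u<v)
  ... | tri≈ _ u≡v _ = contradiction u≡v u≢v
  ... | tri> _ _ v<u = subst (0# <_) (dist-sym v u) (gap-pos (increasing v<u))

  point-mono : ∀ {u v} → u Fin.≤ v → point u ≤ point v
  point-mono {u} {v} u≤v with u Fin.≟ v
  ... | yes refl = ≤-refl
  ... | no  u≢v  = proj₁ (increasing (Fin.≤∧≢⇒< u≤v u≢v))

  point-reflect : ∀ {u v} → point u ≤ point v → u Fin.≤ v
  point-reflect {u} {v} pu≤pv with u Fin.≤? v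
  ... | yes u≤v = u≤v
  ... | no  u≰v = contradiction pu≤pv (<⇒≱ (increasing (ℕ.≰⇒> u≰v)))

  dist-between : ∀ {u v w} → u Fin.≤ v → v Fin.≤ w → dist u v + dist v w ≡ dist u w
  dist-between u≤v v≤w = gap-between (point-mono u≤v) (point-mono v≤w)

  dist-between′ : ∀ {u v w} → v Fin.≤ u → w Fin.≤ v → dist u v + dist v w ≡ dist u w
  dist-between′ {u} {v} {w} v≤u w≤v =
    trans (cong₂ _+_ (dist-sym u v) (dist-sym v w))
      (trans (+-comm (dist v u) (dist w v)) (trans (dist-between w≤v v≤u) (dist-sym w u)))

  len-nonNeg : ∀ u vs → 0# ≤ len u vs
  len-nonNeg u []       = ≤-refl
  len-nonNeg u (v ∷ vs) = 0≤x+y (dist-nonNeg u v) (len-nonNeg v vs)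

  len-++ : ∀ u vs ws → len u (vs ++ ws) ≡ len u vs + len (end u vs) ws
  len-++ u []       ws = sym (+-identityˡ _)
  len-++ u (v ∷ vs) ws = trans (cong (dist u v +_) (len-++ v vs ws)) (sym (+-assoc _ _ _))

  end-++ : ∀ u vs ws → end u (vs ++ ws) ≡ end (end u vs) ws
  end-++ u []       ws = refl
  end-++ u (v ∷ vs) ws = end-++ v vs ws

  end-visited : ∀ u vs → end u vs ∈ u ∷ vs
  end-visited u []       = here refl
  end-visited u (v ∷ vs) = there (end-visited v vs)

  visit-len : ∀ u vs {x} → x ∈ u ∷ vs → dist u x + dist x (end u vs) ≤ len u vs
  visit-len u []       {x} (here refl) = ≤-reflexive (trans (cong₂ _+_ (dist-refl x) (dist-refl x)) (+-identityˡ _))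
  visit-len u (v ∷ vs) {x} (here refl) = ≤-trans
    (≤-reflexive (trans (cong (_+ dist x (end v vs)) (dist-refl x)) (+-identityˡ _)))
    (≤-trans (dist-triangle x v _) (≤-refl +≤ ≤-trans (x≤y+x _ (dist-nonNeg v v)) (visit-len v vs (here refl))))
  visit-len u (v ∷ vs) {x} (there x∈) =
    linear (dist-triangle u v x +≤ visit-len v vs x∈)
      (solve 5 (λ ux xe uv vx l → ux :+ xe :+ (uv :+ vx :+ l) := uv :+ l :+ (ux :+ (vx :+ xe))) refl
        (dist u x) (dist x (end v vs)) (dist u v) (dist v x) (len v vs))

  -- The direction is abstract so that the ascending and the descending branch of `monotone` share
  -- one telescoping argument.
  module Directed {_⊏_ : Rel Site 0ℓ} (between : ∀ {u v w} → u ⊏ v → v ⊏ w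
      → dist u v + dist v w ≡ dist u w) where

    len-directed : ∀ u vs → AllPairs _⊏_ (u ∷ vs) → len u vs ≡ dist u (end u vs)
    len-directed u []       _ = sym (dist-refl u)
    len-directed u (v ∷ vs) ((u⊏v ∷ _) ∷ p@(v⊏vs ∷ _)) =
      trans (cong (dist u v +_) (len-directed v vs p)) (extend (end-visited v vs))
      where
      extend : ∀ {w} → w ∈ v ∷ vs → dist u v + dist v w ≡ dist u w
      extend (here refl) = trans (cong (dist u v +_) (dist-refl v)) (+-identityʳ _)
      extend (there w∈)  = between u⊏v (All.lookup v⊏vs w∈)

    end-directed : ∀ u vs {t} → AllPairs _⊏_ (u ∷ vs) → t ∈ u ∷ vs → All (λ w → ¬ (t ⊏ w)) vs → end u vs ≡ t
    end-directed u []       _                  (here refl) _         = refl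
    end-directed u (v ∷ vs) ((u⊏v ∷ _) ∷ _)    (here refl) (u⊏̸v ∷ _) = contradiction u⊏v u⊏̸v
    end-directed u (v ∷ vs) (_ ∷ p)            (there t∈)  (_ ∷ q)   = end-directed v vs p t∈ q

  sites-increasing : AllPairs Fin._<_ sites
  sites-increasing = AllPairs.tabulate⁺-< (λ i<j → i<j)

  module Up = Directed {Fin._<_} (λ u<v v<w → dist-between (ℕ.<⇒≤ u<v) (ℕ.<⇒≤ v<w))
  module Down = Directed {flip Fin._<_} (λ u>v v>w → dist-between′ (ℕ.<⇒≤ u>v) (ℕ.<⇒≤ v>w))

  end-monotone : ∀ u v → end u (monotone u v) ≡ v
  len-monotone′ : ∀ u v → len u (monotone u v) ≡ dist u (end u (monotone u v))
  end-monotone u v with u Fin.≤? v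
  ... | yes u≤v = Up.end-directed u _ (All.map proj₁ (All.all-filter _ sites) ∷ AllPairs.filter⁺ _ sites-increasing)
                    target (All.map (λ (_ , w≤v) → ℕ.≤⇒≯ w≤v) (All.all-filter _ sites))
    where
    target : v ∈ u ∷ _
    target with u Fin.≟ v
    ... | yes refl = here refl
    ... | no  u≢v  = there (∈-filter⁺ _ (∈-allFin v) (Fin.≤∧≢⇒< u≤v u≢v , Fin.≤-refl))
  ... | no  u≰v = Down.end-directed u _
                    (All.tabulate (λ w∈ → proj₂ (proj₂ (∈-filter⁻ _ {xs = sites} (reverse⁻ w∈))))
                      ∷ AllPairs-reverse _ (AllPairs.filter⁺ _ sites-increasing))
                    (there (reverse⁺ (∈-filter⁺ _ (∈-allFin v) (Fin.≤-refl , ℕ.≰⇒> u≰v))))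
                    (All.tabulate (λ w∈ → ℕ.≤⇒≯ (proj₁ (proj₂ (∈-filter⁻ _ {xs = sites} (reverse⁻ w∈))))))
  len-monotone′ u v with u Fin.≤? v
  ... | yes u≤v = Up.len-directed u _ (All.map proj₁ (All.all-filter _ sites) ∷ AllPairs.filter⁺ _ sites-increasing)
  ... | no  u≰v = Down.len-directed u _
                    (All.tabulate (λ w∈ → proj₂ (proj₂ (∈-filter⁻ _ {xs = sites} (reverse⁻ w∈))))
                      ∷ AllPairs-reverse _ (AllPairs.filter⁺ _ sites-increasing))

  len-monotone : ∀ u v → len u (monotone u v) ≡ dist u v
  len-monotone u v = trans (len-monotone′ u v) (cong (dist u) (end-monotone u v))

  ∈-monotone⁺ : ∀ {u v w} → u Fin.≤ w → w Fin.≤ v → w ∈ u ∷ monotone u v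
  ∈-monotone⁺ {u} {v} {w} u≤w w≤v with u Fin.≤? v | u Fin.≟ w
  ... | yes _   | yes refl = here refl
  ... | yes _   | no  u≢w  = there (∈-filter⁺ _ (∈-allFin w) (Fin.≤∧≢⇒< u≤w u≢w , w≤v))
  ... | no  u≰v | _        = contradiction (ℕ.≤-trans u≤w w≤v) u≰v

  ∈-monotone⁻ : ∀ {u v w} → w ∈ monotone u v → (u Fin.≤ w × w Fin.≤ v) ⊎ (v Fin.≤ w × w Fin.≤ u)
  ∈-monotone⁻ {u} {v} w∈ with u Fin.≤? v
  ... | yes _ with (_ , u<w , w≤v) ← ∈-filter⁻ _ {xs = sites} w∈ = inj₁ (ℕ.<⇒≤ u<w , w≤v)
  ... | no  _ with (_ , v≤w , w<u) ← ∈-filter⁻ _ {xs = sites} (reverse⁻ w∈) = inj₂ (v≤w , ℕ.<⇒≤ w<u)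

  ∈-window⁺ : ∀ {s r v} → dist s v ≤ r → v ∈ window s r
  ∈-window⁺ {s} {r} {v} sv≤r = ∈-filter⁺ _ (∈-allFin v)
    ( x≤y+z⇒x-z≤y (subst (point s ≤_) (+-comm r (point v)) (≤-trans (≤-gapˡ (point s) (point v)) (sv≤r
        +≤ ≤-refl)))
    , subst (point v ≤_) (+-comm r (point s)) (≤-trans (≤-gapʳ (point s) (point v)) (sv≤r +≤ ≤-refl)))

  ∈-window⁻ : ∀ {s r v} → v ∈ window s r → dist s v ≤ r
  ∈-window⁻ {s} {r} {v} v∈ with (_ , s-r≤v , v≤s+r) ← ∈-filter⁻ _ {xs = sites} v∈ = gap-≤
    (subst (point s ≤_) (+-comm (point v) r) (x-z≤y⇒x≤y+z s-r≤v))
    (subst (point v ≤_) (+-comm (point s) r) v≤s+r)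

  module _ {s : Site} {r : ℝ} (0≤r : 0# ≤ r) where

    private
      L = leftmost s r
      T = rightmost s r

    dist-anchor : dist s s ≤ r
    dist-anchor = subst (_≤ r) (sym (dist-refl s)) 0≤r

    leftmost-dist : dist s L ≤ r
    leftmost-dist = argmin-all point {P = λ v → dist s v ≤ r} dist-anchor (All.tabulate ∈-window⁻)

    rightmost-dist : dist s T ≤ r
    rightmost-dist = argmax-all point {P = λ v → dist s v ≤ r} dist-anchor (All.tabulate ∈-window⁻)

    between-dist : ∀ {u v w} → dist s u ≤ r → dist s v ≤ r → u Fin.≤ w → w Fin.≤ v → dist s w ≤ r
    between-dist {u} {v} {w} su≤r sv≤r u≤w w≤v = gap-≤
      (≤-trans (≤-gapˡ (point s) (point u)) (su≤r +≤ point-mono u≤w))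
      (≤-trans (point-mono w≤v) (≤-trans (≤-gapʳ (point s) (point v)) (sv≤r +≤ ≤-refl)))

    monotone-dist : ∀ {u v w} → dist s u ≤ r → dist s v ≤ r → w ∈ monotone u v → dist s w ≤ r
    monotone-dist su≤r sv≤r w∈ with ∈-monotone⁻ w∈
    ... | inj₁ (u≤w , w≤v) = between-dist su≤r sv≤r u≤w w≤v
    ... | inj₂ (v≤w , w≤u) = between-dist sv≤r su≤r v≤w w≤u

    sweep-within : ∀ {v} → v ∈ s ∷ sweep s r → dist s v ≤ r
    sweep-within (here refl) = dist-anchor
    sweep-within (there v∈) with ∈-++⁻ (monotone s L) v∈
    ... | inj₁ v∈sL = monotone-dist dist-anchor leftmost-dist v∈sL
    ... | inj₂ v∈ʳ with ∈-++⁻ (monotone L T) v∈ʳ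
    ...   | inj₁ v∈LT = monotone-dist leftmost-dist rightmost-dist v∈LT
    ...   | inj₂ v∈Ts = monotone-dist rightmost-dist dist-anchor v∈Ts

    -- The middle leg alone, from the leftmost to the rightmost site of the window, passes the whole
    -- window. Only its starting site `L`, which `monotone L T` does not list, is taken from the end
    -- of the first leg.
    sweep-covers : ∀ {v} → dist s v ≤ r → v ∈ s ∷ sweep s r
    sweep-covers {v} sv≤r with ∈-monotone⁺ {L} {T} {v} (point-reflect (All.lookup (f[argmin]≤f[xs] s (window s r)) (∈-window⁺ sv≤r)))
                                           (point-reflect (All.lookup (f[xs]≤f[argmax] s (window s r)) (∈-window⁺ sv≤r)))
    ... | there v∈  = there (∈-++⁺ʳ (monotone s L) (∈-++⁺ˡ v∈))
    ... | here refl = visited (subst (_∈ s ∷ monotone s L) (end-monotone s L) (end-visited s (monotone s L)))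
      where
      visited : L ∈ s ∷ monotone s L → L ∈ s ∷ sweep s r
      visited (here eq)  = here eq
      visited (there L∈) = there (∈-++⁺ˡ L∈)

    sweep-end : end s (sweep s r) ≡ s
    sweep-end = trans (end-++ s (monotone s L) _)
      (trans (cong (λ u → end u (monotone L T ++ monotone T s)) (end-monotone s L))
        (trans (end-++ L (monotone L T) _)
          (trans (cong (λ u → end u (monotone T s)) (end-monotone L T)) (end-monotone T s))))

    -- The middle leg is at most `sL + sT`, so each of the two distances from the anchor is paid at
    -- most twice.
    sweep-len : len s (sweep s r) ≤ r + r + (r + r)
    sweep-len = ≤-trans (≤-reflexive len≡)
      (linear (leftmost-dist +≤ leftmost-dist +≤ rightmost-dist +≤ rightmost-dist +≤ dist-triangle L s T)
        (subst₂ (λ Ls Ts → sL + (LT + Ts) + (r + r + r + r + (Ls + sT)) ≡ r + r + (r + r) + (sL + sL + sT + sT + LT))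
          (dist-sym s L) (dist-sym s T)
          (solve 4 (λ sL sT LT r → sL :+ (LT :+ sT) :+ (r :+ r :+ r :+ r :+ (sL :+ sT))
                                  := r :+ r :+ (r :+ r) :+ (sL :+ sL :+ sT :+ sT :+ LT)) refl sL sT LT r)))
      where
      sL = dist s L
      sT = dist s T
      LT = dist L T
      len≡ : len s (sweep s r) ≡ sL + (LT + dist T s)
      len≡ = trans (len-++ s (monotone s L) _) (cong₂ _+_ (len-monotone s L)
        (trans (cong (λ u → len u (monotone L T ++ monotone T s)) (end-monotone s L))
          (trans (len-++ L (monotone L T) _) (cong₂ _+_ (len-monotone L T)
            (trans (cong (λ u → len u (monotone T s)) (end-monotone L T)) (len-monotone T s))))))

  δ-≤-dist : ∀ {u v} → u ≢ v → δ ≤ dist u v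
  δ-≤-dist {u} {v} u≢v = All.lookup (min≤xs _ _)
    (∈-map⁺ (uncurry dist) (∈-filter⁺ _ (∈-cartesianProduct⁺ (∈-allFin u) (∈-allFin v)) u≢v))

  0<δ : 0# < δ
  0<δ = v<min⁺ (gap-pos (increasing (subst₂ ℕ._<_ (sym (Fin.toℕ-fromℕ< _)) (sym (Fin.toℕ-fromℕ< _)) ℕ.z<s)))
    (All.map⁺ (All.map (λ {(u , v)} → dist-pos) (All.all-filter _ (cartesianProduct sites sites))))

  radius-suc : ∀ j → radius (suc j) ≡ radius j + radius j
  radius-suc j = trans (cong (_* δ) (trans (fromℕ-homo-+ (2 ℕ.^ j) _)
    (cong (λ n → fromℕ (2 ℕ.^ j) + fromℕ n) (ℕ.+-identityʳ (2 ℕ.^ j))))) (distribʳ δ _ _)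

  radius-zero : radius 0 ≡ δ
  radius-zero = trans (cong (_* δ) (+-identityʳ 1#)) (*-identityˡ δ)

  radius-zero-≤ : ∀ {u v} → u ≢ v → radius 0 ≤ dist u v
  radius-zero-≤ {u} {v} u≢v = subst (_≤ dist u v) (sym radius-zero) (δ-≤-dist u≢v)

  radius-nonNeg : ∀ j → 0# ≤ radius j
  radius-nonNeg j = *-nonNeg (fromℕ-nonNeg (2 ℕ.^ j)) (proj₁ 0<δ)

  n≤2^n : ∀ n → n ℕ.≤ 2 ℕ.^ n
  n≤2^n zero    = ℕ.z≤n
  n≤2^n (suc n) = ℕ.+-mono-≤ (ℕ.m^n>0 2 n) (ℕ.≤-trans (n≤2^n n) (ℕ.m≤m+n _ _))

  diameter : ℝ
  diameter = max 0# (map (uncurry dist) (cartesianProduct sites sites))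

  dist-≤-diameter : ∀ u v → dist u v ≤ diameter
  dist-≤-diameter u v = All.lookup (xs≤max 0# (map (uncurry dist) (cartesianProduct sites sites)))
    (∈-map⁺ (uncurry dist) (∈-cartesianProduct⁺ (∈-allFin u) (∈-allFin v)))

  -- Any `N` above `diameter / δ` works, because `N ≤ 2 ^ N`.
  radius-unbounded : ∃[ N ] (∀ u v → dist u v ≤ radius N)
  radius-unbounded with positive-inverse 0<δ
  ... | d , 0≤d , δd≡1 with archimedean (d * diameter)
  ...   | N , dD≤N = N , λ u v → ≤-trans (dist-≤-diameter u v) (subst (_≤ radius N) dDδ≡D
            (*-monoʳ-≤ (proj₁ 0<δ) (≤-trans dD≤N (fromℕ-mono-≤ (n≤2^n N)))))
    where
    dDδ≡D : d * diameter * δ ≡ diameter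
    dDδ≡D = trans (solve 3 (λ d D δ → d :* D :* δ := δ :* d :* D) refl d diameter δ)
      (trans (cong (_* diameter) δd≡1) (*-identityˡ diameter))

-- Automatic service and the places that a schedule has to visit.

module ServiceProperties (R : RealNumbers) (X : FiniteSubset R) (s₀ : FiniteSubset.Site X) (I : Input R X) where
  open RealNumbers R
  open OrderedFieldProperties R
  open FiniteSubset X
  open Geometry R X
  open GeometryProperties R X
  open Input I
  open Service R X s₀ I
  open Server
  open Data.List.Extrema totalOrder using (max≤v⁺; ⊥≤max; xs≤max)
  open DecMembership (Fin._≟_ {count}) using () renaming (_∈?_ to _∈ᵣ?_)
  open DecMembership (Fin._≟_ {size}) using () renaming (_∈?_ to _∈ₛ?_)

  path : Schedule → List Site
  path = concatMap (concat ∘ Action.components)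

  walks-position : ∀ t c ws → position (walks t c ws) ≡ end (position c) (concat ws)
  walks-position t c []       = refl
  walks-position t c (w ∷ ws) = trans (walks-position t (walk t c w) ws) (sym (end-++ (position c) w (concat ws)))

  run-position : ∀ c S → position (run c S) ≡ end (position c) (path S)
  run-position c []                      = refl
  run-position c ((at t perform ws) ∷ S) = trans (run-position _ S)
    (trans (cong (λ u → end u (path S)) (walks-position t (await t c) ws)) (sym (end-++ (position c) (concat ws) (path S))))

  run-++ : ∀ c S T → run c (S ++ T) ≡ run (run c S) T
  run-++ c []                      T = refl
  run-++ c ((at t perform ws) ∷ S) T = run-++ _ S T

  runCost-++ : ∀ c S T → runCost c (S ++ T) ≡ runCost c S + runCost (run c S) T
  runCost-++ c []                      T = sym (+-identityˡ _)
  runCost-++ c ((at t perform ws) ∷ S) T = trans (cong (walksCost t (await t c) ws +_) (runCost-++ _ S T)) (sym (+-assoc _ _ _))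

  ∈-await⁺ : ∀ {t c q} → arrival q ≤ t → location q ≡ position c → q ∈ served (await t c)
  ∈-await⁺ {q = q} a≤t q≡c = ∈-++⁺ˡ (∈-filter⁺ _ (∈-allFin q) (a≤t , q≡c))

  ∈-await⁻ : ∀ {t c q} → q ∈ served (await t c) → q ∈ served c ⊎ (arrival q ≤ t × location q ≡ position c)
  ∈-await⁻ {t} {c} q∈ with ∈-++⁻ (filter (λ q → arrival q ≤? t ×-dec location q Fin.≟ position c) requests) q∈
  ... | inj₁ q∈free   = inj₂ (proj₂ (∈-filter⁻ _ {xs = requests} q∈free))
  ... | inj₂ q∈served = inj₁ q∈served

  ∈-hit⁺ : ∀ {t c w q} → arrival q ≤ t → q ∉ served c → location q ∈ position c ∷ w → q ∈ hit t c w
  ∈-hit⁺ {q = q} a≤t q∉ q∈w = ∈-filter⁺ _ (∈-allFin q) ((a≤t , q∉) , q∈w)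

  ∈-hit⁻ : ∀ {t c w q} → q ∈ hit t c w → (arrival q ≤ t × q ∉ served c) × location q ∈ position c ∷ w
  ∈-hit⁻ q∈ = proj₂ (∈-filter⁻ _ {xs = requests} q∈)

  ∈-walk⁺ : ∀ {t c w q} → arrival q ≤ t → location q ∈ position c ∷ w → q ∈ served (walk t c w)
  ∈-walk⁺ {t} {c} {w} {q} a≤t q∈w with q ∈ᵣ? served c
  ... | yes q∈ = ∈-++⁺ʳ (hit t c w) q∈
  ... | no  q∉ = ∈-++⁺ˡ (∈-hit⁺ a≤t q∉ q∈w)

  ∈-walk⁻ : ∀ {t c w q} → q ∈ served (walk t c w) → q ∈ served c ⊎ (arrival q ≤ t × location q ∈ position c ∷ w)
  ∈-walk⁻ {t} {c} {w} q∈ with ∈-++⁻ (hit t c w) q∈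
  ... | inj₁ q∈hit with ((a≤t , _) , q∈w) ← ∈-hit⁻ {t} {c} {w} q∈hit = inj₂ (a≤t , q∈w)
  ... | inj₂ q∈served = inj₁ q∈served

  visited-++ : ∀ u w {vs x} → x ∈ end u w ∷ vs → x ∈ u ∷ (w ++ vs)
  visited-++ u []       x∈ = x∈
  visited-++ u (v ∷ vs) x∈ = there (visited-++ v vs x∈)

  ∈-walks⁻ : ∀ {t} c ws {q} → q ∈ served (walks t c ws) →
             q ∈ served c ⊎ (arrival q ≤ t × location q ∈ position c ∷ concat ws)
  ∈-walks⁻ c []       q∈ = inj₁ q∈
  ∈-walks⁻ {t} c (w ∷ ws) q∈ with ∈-walks⁻ (walk t c w) ws q∈
  ... | inj₂ (a≤t , q∈ws) = inj₂ (a≤t , visited-++ (position c) w q∈ws)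
  ... | inj₁ q∈w with ∈-walk⁻ {t} {c} {w} q∈w
  ...   | inj₁ q∈c          = inj₁ q∈c
  ...   | inj₂ (a≤t , q∈cw) = inj₂ (a≤t , ∈-++⁺ˡ q∈cw)

  ⊆-walks : ∀ {t} c ws {q} → q ∈ served c → q ∈ served (walks t c ws)
  ⊆-walks c []           q∈ = q∈
  ⊆-walks {t} c (w ∷ ws) q∈ = ⊆-walks (walk t c w) ws (∈-++⁺ʳ (hit t c w) q∈)

  ⊆-action : ∀ {t} c ws {q} → q ∈ served c → q ∈ served (walks t (await t c) ws)
  ⊆-action {t} c ws q∈ = ⊆-walks (await t c) ws (∈-++⁺ʳ (filter _ requests) q∈)

  ⊆-run : ∀ c S {q} → q ∈ served c → q ∈ served (run c S)
  ⊆-run c []                      q∈ = q∈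
  ⊆-run c ((at t perform ws) ∷ S) q∈ = ⊆-run _ S (⊆-action c ws q∈)

  ∈-action⁻ : ∀ {t} c ws {q} → q ∈ served (walks t (await t c) ws) →
              q ∈ served c ⊎ (arrival q ≤ t × location q ∈ position c ∷ concat ws)
  ∈-action⁻ {t} c ws q∈ with ∈-walks⁻ (await t c) ws q∈
  ... | inj₂ p = inj₂ p
  ... | inj₁ q∈await with ∈-await⁻ {t} {c} q∈await
  ...   | inj₁ q∈c          = inj₁ q∈c
  ...   | inj₂ (a≤t , refl) = inj₂ (a≤t , here refl)

  ∈-run⁻ : ∀ c S {q} → q ∈ served (run c S) → q ∈ served c ⊎ location q ∈ position c ∷ path S
  ∈-run⁻ c []                      q∈ = inj₁ q∈
  ∈-run⁻ c ((at t perform ws) ∷ S) q∈ with ∈-run⁻ _ S q∈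
  ... | inj₂ q∈S = inj₂ (visited-++ (position c) (concat ws)
                     (subst (λ u → _ ∈ u ∷ path S) (walks-position t (await t c) ws) q∈S))
  ... | inj₁ q∈ws with ∈-action⁻ c ws q∈ws
  ...   | inj₁ q∈c        = inj₁ q∈c
  ...   | inj₂ (_ , q∈cw) = inj₂ (∈-++⁺ˡ q∈cw)

  -- Zero-cost service is recorded only by the `await` of the next action. A request at the current
  -- position therefore counts as settled although it is not yet in `served`.
  Resolved : Server → Request → Set
  Resolved c q = q ∈ served c ⊎ location q ≡ position c

  resolved? : ∀ c → Decidable (Resolved c)
  resolved? c q with q ∈ᵣ? served c | location q Fin.≟ position c
  ... | yes q∈ | _       = yes (inj₁ q∈)
  ... | no  _  | yes q≡  = yes (inj₂ q≡)
  ... | no  q∉ | no  q≢  = no [ q∉ , q≢ ]′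

  -- Settling `q` forces the path through its location: an action passed it, or the server ended
  -- there. This turns service into a lower bound on movement.
  resolved-visit : ∀ c S {q} → q ∉ served c → Resolved (run c S) q →
    dist (position c) (location q) + dist (location q) (position (run c S)) ≤ len (position c) (path S)
  resolved-visit c S {q} q∉ r =
    subst (λ u → dist (position c) (location q) + dist (location q) u ≤ len (position c) (path S)) (sym (run-position c S))
    (visit-len (position c) (path S) (visited r))
    where
    visited : Resolved (run c S) q → location q ∈ position c ∷ path S
    visited (inj₁ q∈) = [ (λ q∈c → contradiction q∈c q∉) , (λ q∈S → q∈S) ]′ (∈-run⁻ c S q∈)
    visited (inj₂ q≡) = subst (_∈ position c ∷ path S) (sym (trans q≡ (run-position c S))) (end-visited (position c) (path S))

  data Timed : ℝ → Schedule → ℝ → Set where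
    []  : ∀ {t τ} → t ≤ τ → Timed t [] τ
    _∷_ : ∀ {t t′ τ ws S} → t ≤ t′ → Timed t′ S τ → Timed t ((at t′ perform ws) ∷ S) τ

  timed-≤ : ∀ {t S τ} → Timed t S τ → t ≤ τ
  timed-≤ ([] t≤τ)    = t≤τ
  timed-≤ (t≤t′ ∷ tm) = ≤-trans t≤t′ (timed-≤ tm)

  served-arrived : ∀ {t S τ} c → Timed t S τ → (∀ {q} → q ∈ served c → arrival q ≤ t) →
                   ∀ {q} → q ∈ served (run c S) → arrival q ≤ τ
  served-arrived c ([] t≤τ) h q∈ = ≤-trans (h q∈) t≤τ
  served-arrived c (_∷_ {ws = ws} t≤t′ tm) h q∈ = served-arrived _ tm
    (λ q∈′ → [ (λ q∈c → ≤-trans (h q∈c) t≤t′) , proj₁ ]′ (∈-action⁻ c ws q∈′)) q∈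

  Sorted : ℝ → Schedule → Set
  Sorted t S = Linked _≤_ (t ∷ map Action.time S)

  timed-split : ∀ {t} S τ → Sorted t S → t ≤ τ →
                ∃[ S₁ ] ∃[ S₂ ] S ≡ S₁ ++ S₂ × Timed t S₁ τ × Sorted τ S₂
  timed-split []      τ _             t≤τ = [] , [] , refl , [] t≤τ , [-]
  timed-split (a ∷ S) τ (t≤a ∷ later) t≤τ with Action.time a ≤? τ
  ... | no  a≰τ = [] , a ∷ S , refl , [] t≤τ , proj₁ (≰⇒> a≰τ) ∷ later
  ... | yes a≤τ with timed-split S τ later a≤τ
  ...   | S₁ , S₂ , refl , tm , st = a ∷ S₁ , S₂ , refl , t≤a ∷ tm , st

  timed-total : ∀ {t} S → Sorted t S → ∃[ τ ] Timed t S τ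
  timed-total []      _         = _ , [] ≤-refl
  timed-total (a ∷ S) (t≤a ∷ l) with timed-total S l
  ... | τ , tm = τ , t≤a ∷ tm

  -- Accrued delay as a running cost.

  Pending : Server → ℝ → Request → Set
  Pending c t q = arrival q ≤ t × ¬ Resolved c q

  pending? : ∀ c t → Decidable (Pending c t)
  pending? c t q = arrival q ≤? t ×-dec ¬? (resolved? c q)

  -- The delay accrued so far by the oldest pending request: it turns the
  -- maximum delay, charged only when an event occurs, into a running cost.
  age : Server → ℝ → ℝ
  age c t = max 0# (map (λ q → t - arrival q) (filter (pending? c t) requests))

  age-nonNeg : ∀ c t → 0# ≤ age c t
  age-nonNeg c t = ⊥≤max 0# (map (λ q → t - arrival q) (filter (pending? c t) requests))

  ≤-age : ∀ c t {q} → Pending c t q → t ≤ age c t + arrival q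
  ≤-age c t {q} p = x-z≤y⇒x≤y+z (All.lookup (xs≤max 0# _)
    (∈-map⁺ (λ q → t - arrival q) (∈-filter⁺ (pending? c t) (∈-allFin q) p)))

  -- The universal property of the maximum, arranged without subtraction; `m ≤ x` takes care of its
  -- default value 0.
  age-≤ : ∀ c t {x m} → m ≤ x → (∀ {q} → Pending c t q → t + m ≤ x + arrival q) → age c t + m ≤ x
  age-≤ c t {x} {m} m≤x h = subst (age c t + m ≤_) (x-y+y x m)
    (max≤v⁺ (shift (subst (_≤ x) (sym (+-identityˡ m)) m≤x))
      (All.map⁺ (All.map (λ {q} p → x≤y+z⇒x-z≤y (shift′ (h p))) (All.all-filter (pending? c t) requests)))
          +≤ ≤-refl)
    where
    shift : ∀ {y} → y + m ≤ x → y ≤ x - m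
    shift {y} p = +-cancelʳ-≤ m (subst (y + m ≤_) (sym (x-y+y x m)) p)
    shift′ : ∀ {a} → t + m ≤ x + a → t ≤ x - m + a
    shift′ {a} p = +-cancelʳ-≤ m (subst (t + m ≤_)
      (trans (cong (_+ a) (sym (x-y+y x m))) (solve 3 (λ y m a → y :+ m :+ a
          := y :+ a :+ m) refl (x - m) m a)) p)

  -- Between actions the age increases at unit rate while something is pending. A request that
  -- determines the age at `t₀` keeps waiting until `t`; if nothing was pending at `t₀`, the wait of
  -- `z`, which has arrived by `b`, supplies the increase.
  age-grows : ∀ c {t₀ t b z} → t₀ ≤ b → t₀ ≤ t → Pending c t z → arrival z ≤ b → age c t₀ + t ≤ age c t + b
  age-grows c {t₀} {t} {b} {z} t₀≤b t₀≤t pz az≤b = age-≤ c t₀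
    (≤-trans (≤-age c t pz) (≤-refl +≤ az≤b))
    (λ {q} (a≤t₀ , ¬r) → linear (t₀≤b +≤ ≤-age c t (≤-trans a≤t₀ t₀≤t , ¬r))
      (solve 5 (λ t₀ t A b a → t₀ :+ t :+ (b :+ (A :+ a))
          := A :+ b :+ a :+ (t₀ :+ t)) refl t₀ t (age c t) b (arrival q)))

  age-mono : ∀ c {t₀ t} → t₀ ≤ t → age c t₀ ≤ age c t
  age-mono c {t₀} {t} t₀≤t = subst (_≤ age c t) (+-identityʳ _) (age-≤ c t₀ (age-nonNeg c t)
    (λ (a≤t₀ , ¬r) → subst (_≤ _) (sym (+-identityʳ t₀)) (≤-trans t₀≤t (≤-age c t (≤-trans a≤t₀ t₀≤t , ¬r)))))

  len≤walkCost : ∀ t c w → len (position c) w ≤ walkCost t c w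
  len≤walkCost t c w = x≤x+y _ (⊥≤max 0# (map (λ q → t - arrival q) (hit t c w)))

  hit-cost : ∀ t c w {q} → q ∈ hit t c w → len (position c) w + t ≤ walkCost t c w + arrival q
  hit-cost t c w {q} q∈ = subst (len (position c) w + t ≤_) (sym (+-assoc _ _ _))
    (≤-refl +≤ x-z≤y⇒x≤y+z (All.lookup (xs≤max 0# _) (∈-map⁺ (λ q → t - arrival q) q∈)))

  walks-len : ∀ t c ws → len (position c) (concat ws) ≤ walksCost t c ws
  walks-len t c []       = ≤-refl
  walks-len t c (w ∷ ws) = ≤-trans (≤-reflexive (len-++ (position c) w (concat ws)))
    (len≤walkCost t c w +≤ walks-len t (walk t c w) ws)

  -- The component that first visits `q` charges its delay, and all other components contribute at
  -- least their lengths.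
  walks-delay : ∀ t c ws {q} → arrival q ≤ t → q ∉ served c →
    len (position c) (concat ws) + t ≤ walksCost t c ws + arrival q
      ⊎ (q ∉ served (walks t c ws) × location q ∉ concat ws)
  walks-delay t c []       a≤t q∉ = inj₂ (q∉ , λ ())
  walks-delay t c (w ∷ ws) {q} a≤t q∉ with location q ∈ₛ? (position c ∷ w)
  ... | yes q∈w = inj₁ (subst (λ l
      → l + t ≤ walksCost t c (w ∷ ws) + arrival q) (sym (len-++ (position c) w (concat ws)))
        (linear (hit-cost t c w (∈-hit⁺ a≤t q∉ q∈w) +≤ walks-len t (walk t c w) ws)
          (solve 6 (λ l m t k k′ a → l :+ m :+ t :+ (k :+ a :+ k′) := k :+ k′ :+ a :+ (l :+ t :+ m)) refl
            (len (position c) w) (len (end (position c) w) (concat ws)) t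
            (walkCost t c w) (walksCost t (walk t c w) ws) (arrival q))))
  ... | no  q∉w with walks-delay t (walk t c w) ws {q} a≤t
                       (λ q∈ → [ q∉ , (λ (_ , q∈w) → q∉w q∈w) ]′ (∈-walk⁻ {t} {c} {w} q∈))
  ...   | inj₁ cost≥ = inj₁ (subst (λ l
      → l + t ≤ walksCost t c (w ∷ ws) + arrival q) (sym (len-++ (position c) w (concat ws)))
        (linear (len≤walkCost t c w +≤ cost≥)
          (solve 6 (λ l m t k k′ a → l :+ m :+ t :+ (k :+ (k′ :+ a)) := k :+ k′ :+ a :+ (l :+ (m :+ t))) refl
            (len (position c) w) (len (end (position c) w) (concat ws)) t
            (walkCost t c w) (walksCost t (walk t c w) ws) (arrival q))))
  ...   | inj₂ (q∉′ , q∉ws) = inj₂ (q∉′ , λ q∈ → [ (λ q∈w → q∉w (there q∈w)) , q∉ws ]′ (∈-++⁻ w q∈))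

  -- A request that determines the age before the action is either served, and then its delay is
  -- charged on top of the full length, or still pending, and then it keeps the age up. So an action
  -- never loses accrued delay without paying for it.
  action-gain : ∀ t c ws → let c′ = walks t (await t c) ws in
    age c t + len (position c) (concat ws) ≤ age c′ t + walksCost t (await t c) ws
  action-gain t c ws = age-≤ c t (≤-trans (walks-len t (await t c) ws) (x≤y+x _ (age-nonNeg c′ t)))
    (λ {q} (a≤t , ¬r) → bound q a≤t ¬r (walks-delay t (await t c) ws a≤t
      (λ q∈ → [ ¬r ∘ inj₁ , ¬r ∘ inj₂ ∘ proj₂ ]′ (∈-await⁻ {t} {c} q∈))))
    where
    c′ = walks t (await t c) ws
    l  = len (position c) (concat ws)
    k  = walksCost t (await t c) ws
    bound : ∀ q → arrival q ≤ t → ¬ Resolved c q →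
            l + t ≤ k + arrival q ⊎ (q ∉ served c′ × location q ∉ concat ws) →
            t + l ≤ age c′ t + k + arrival q
    bound q a≤t ¬r (inj₁ p) = linear (p +≤ age-nonNeg c′ t)
      (solve 5 (λ l t k a A → t :+ l :+ (k :+ a :+ A)
          := A :+ k :+ a :+ (l :+ t :+ con 0)) refl l t k (arrival q) (age c′ t))
    bound q a≤t ¬r (inj₂ (q∉c′ , q∉ws)) = linear (≤-age c′ t (a≤t , [ q∉c′ , elsewhere ]′)
        +≤ walks-len t (await t c) ws)
      (solve 5 (λ l t k a A → t :+ l :+ (A :+ a :+ k)
          := A :+ k :+ a :+ (t :+ l)) refl l t k (arrival q) (age c′ t))
      where
      -- The final position lies on the path, so a request there was already at the starting
      -- position or was visited.
      elsewhere : location q ≢ position c′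
      elsewhere q≡ with subst (_∈ position c ∷ concat ws) (sym (trans q≡ (walks-position t (await t c) ws)))
                              (end-visited (position c) (concat ws))
      ... | here q≡c   = ¬r (inj₂ q≡c)
      ... | there q∈ws = q∉ws q∈ws

  path-len : ∀ t c ws S → len (position c) (path ((at t perform ws) ∷ S)) ≡
             len (position c) (concat ws) + len (position (walks t (await t c) ws)) (path S)
  path-len t c ws S = trans (len-++ (position c) (concat ws) (path S))
    (cong (λ u → len (position c) (concat ws) + len u (path S)) (sym (walks-position t (await t c) ws)))

  movement-gain : ∀ {t₀ S τ} c → Timed t₀ S τ →
    age c t₀ + len (position c) (path S) ≤ age (run c S) τ + runCost c S
  movement-gain c ([] t₀≤τ) = age-mono c t₀≤τ +≤ ≤-refl
  movement-gain {t₀} {τ = τ} c (_∷_ {t′ = t} {ws = ws} {S = S} t₀≤t tm) =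
    subst (λ l → age c t₀ + l ≤ age (run c′ S) τ + (walksCost t (await t c) ws + runCost c′ S)) (sym (path-len t c ws S))
      (linear (age-mono c t₀≤t +≤ action-gain t c ws +≤ movement-gain c′ tm)
        (solve 8 (λ A₀ A A′ A″ l m k k′ → A₀ :+ (l :+ m) :+ (A :+ (A′ :+ k) :+ (A″ :+ k′))
                   := A″ :+ (k :+ k′) :+ (A₀ :+ (A :+ l) :+ (A′ :+ m))) refl
          (age c t₀) (age c t) (age c′ t) (age (run c′ S) τ)
          (len (position c) (concat ws)) (len (position c′) (path S)) (walksCost t (await t c) ws) (runCost c′ S)))
    where c′ = walks t (await t c) ws

  -- An arrived request at the position would be recorded by the `await` of this action and stay
  -- served.
  unresolved-before : ∀ t c ws S {q} → arrival q ≤ t → ¬ Resolved (run (walks t (await t c) ws) S) q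
      → ¬ Resolved c q
  unresolved-before t c ws S a≤t ¬r (inj₁ q∈) = ¬r (inj₁ (⊆-run _ S (⊆-action c ws q∈)))
  unresolved-before t c ws S a≤t ¬r (inj₂ q≡) = ¬r (inj₁ (⊆-run _ S (⊆-walks (await t c) ws (∈-await⁺ {t} {c} a≤t q≡))))

  -- Movement and the wait of one request can be charged together, because movement is paid at the
  -- actions and the age grows between them. Waiting is counted from `b`: actions up to `b` only use
  -- `action-gain`, and an action after `b` collects the elapsed time and becomes the new `b`.
  waiting-gain : ∀ {t₀ S τ b z} c → Timed t₀ S τ → Pending (run c S) τ z → t₀ ≤ b → arrival z ≤ b →
    age c t₀ + len (position c) (path S) + τ ≤ age (run c S) τ + runCost c S + b
  waiting-gain {t₀} {τ = τ} {b} c ([] t₀≤τ) pz t₀≤b az≤b =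
    linear (age-grows c t₀≤b t₀≤τ pz az≤b)
      (solve 4 (λ A A′ b τ → A :+ con 0 :+ τ :+ (A′ :+ b)
          := A′ :+ con 0 :+ b :+ (A :+ τ)) refl (age c t₀) (age c τ) b τ)
  waiting-gain {t₀} {τ = τ} {b} c (_∷_ {t′ = t} {ws = ws} {S = S} t₀≤t tm) pz t₀≤b az≤b =
    subst (λ l → age c t₀ + l + τ ≤ age (run c′ S) τ + (walksCost t (await t c) ws + runCost c′ S) + b)
      (sym (path-len t c ws S)) step
    where
    c′ = walks t (await t c) ws
    step : age c t₀ + (len (position c) (concat ws) + len (position c′) (path S)) + τ
             ≤ age (run c′ S) τ + (walksCost t (await t c) ws + runCost c′ S) + b
    step with ≤-total t b
    ... | inj₁ t≤b = linear (age-mono c t₀≤t +≤ action-gain t c ws +≤ waiting-gain c′ tm pz t≤b az≤b)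
      (solve 10 (λ A₀ A A′ A″ l m k k′ τ b → A₀ :+ (l :+ m) :+ τ :+ (A :+ (A′ :+ k) :+ (A″ :+ k′ :+ b))
                 := A″ :+ (k :+ k′) :+ b :+ (A₀ :+ (A :+ l) :+ (A′ :+ m :+ τ))) refl
        (age c t₀) (age c t) (age c′ t) (age (run c′ S) τ)
        (len (position c) (concat ws)) (len (position c′) (path S)) (walksCost t (await t c) ws) (runCost c′ S) τ b)
    ... | inj₂ b≤t = linear
      (age-grows c t₀≤b t₀≤t (≤-trans az≤b b≤t , unresolved-before t c ws S (≤-trans az≤b b≤t) (proj₂ pz)) az≤b
        +≤ action-gain t c ws +≤ waiting-gain c′ tm pz ≤-refl (≤-trans az≤b b≤t))
      (solve 11 (λ A₀ A A′ A″ l m k k′ τ b t → A₀ :+ (l :+ m) :+ τ :+ (A :+ b :+ (A′ :+ k) :+ (A″ :+ k′ :+ t))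
                 := A″ :+ (k :+ k′) :+ b :+ (A₀ :+ t :+ (A :+ l) :+ (A′ :+ m :+ τ))) refl
        (age c t₀) (age c t) (age c′ t) (age (run c′ S) τ)
        (len (position c) (concat ws)) (len (position c′) (path S)) (walksCost t (await t c) ws) (runCost c′ S) τ b t)

-- Amortised lower bound on the cost of an arbitrary schedule.

module OfflineBound (R : RealNumbers) (X : FiniteSubset R) (s₀ : FiniteSubset.Site X) (I : Input R X) where
  open RealNumbers R
  open OrderedFieldProperties R
  open FiniteSubset X
  open Geometry R X
  open GeometryProperties R X
  open Input I
  open Service R X s₀ I
  open ServiceProperties R X s₀ I
  open Server

  -- Of the ghosts of a phase with anchor s ended at τ by a move to
  -- location p, two matter for the lower bound: the farthest, p, and a
  -- witness q that is at least half as far and that has already waited for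
  -- at least half that distance at τ.
  data Phases : ℝ → Site → ℝ → Set where
    []     : ∀ {t s} → Phases t s 0#
    extend : ∀ {t s total} (p q : Request) (τ : ℝ) → let D = dist s (location p) in
             t < arrival p → arrival p ≤ τ → t < arrival q → arrival q ≤ τ →
             D + t ≤ τ → D + (arrival q + arrival q) ≤ τ + τ →
             D ≤ dist s (location q) + dist s (location q) →
             Phases τ (location p) total → Phases t s (D + total)

  -- What the schedule has in hand towards the phases to come: either the last
  -- farthest ghost p is served, and φ pays for twice the distance to the
  -- anchor, or p is still pending at the anchor.
  data Credit (c : Server) (t : ℝ) (s : Site) (φ : ℝ) : Set where
    near : dist (position c) s + dist (position c) s ≤ φ → Credit c t s φ
    owed : ∀ p → Pending c t p → location p ≡ s → 0# ≤ φ → Credit c t s φ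

  credit-nonNeg : ∀ {c t s φ} → Credit c t s φ → 0# ≤ φ
  credit-nonNeg {c} {s = s} (near 2d≤φ) = ≤-trans (0≤x+y (dist-nonNeg (position c) s) (dist-nonNeg (position c) s)) 2d≤φ
  credit-nonNeg (owed _ _ _ 0≤φ) = 0≤φ

  quadruple : ℝ → ℝ
  quadruple x = x + x + (x + x)

  private
    :4 : ∀ {n} → Polynomial n → Polynomial n
    :4 x = x :+ x :+ (x :+ x)

  -- `A` is the age before the phase, `B` the age after it plus the cost incurred, `M` the movement
  -- and `W` the wait of one request. `W` is existential because different cases wait for different
  -- requests.
  Gain : (D φ φ′ M A B : ℝ) → Set
  Gain D φ φ′ M A B = ∃[ W ] A + M + W ≤ B × D + φ′ ≤ φ + quadruple (M + W)

  settle : ∀ {D φ φ′ M A B} → Gain D φ φ′ M A B → D + φ′ + quadruple A ≤ φ + quadruple B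
  settle {D} {φ} {φ′} {M} {A} {B} (W , p , h) = linear (p +≤ p +≤ p +≤ p +≤ h)
    (solve 7 (λ D φ φ′ M A B W → D :+ φ′ :+ :4 A :+ (B :+ B :+ B :+ B :+ (φ :+ :4 (M :+ W)))
       := φ :+ :4 B :+ (A :+ M :+ W :+ (A :+ M :+ W) :+ (A :+ M :+ W) :+ (A :+ M :+ W) :+ (D
           :+ φ′))) refl D φ φ′ M A B W)

  moved : ∀ {D φ φ′ M A B} → A + M ≤ B → D + φ′ ≤ φ + quadruple M → Gain D φ φ′ M A B
  moved {D} {φ} {φ′} {M} {A} {B} p h =
    0# , subst (_≤ B) (sym (+-identityʳ _)) p , subst (λ x → D + φ′ ≤ φ + quadruple x) (sym (+-identityʳ M)) h

  waited : ∀ {D φ φ′ M A B τ b} → A + M + τ ≤ B + b → (∀ W → W + b ≡ τ → D + φ′ ≤ φ + quadruple (M + W))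
      → Gain D φ φ′ M A B
  waited {M = M} {A} {B} {τ} {b} p h = τ - b ,
    +-cancelʳ-≤ b (subst (_≤ B + b) (trans (cong (A + M +_) (sym (x-y+y τ b))) (sym (+-assoc _ _ _))) p) ,
    h (τ - b) (x-y+y τ b)

  module _ {t : ℝ} {s : Site} (c : Server) (S : Schedule) (p q : Request) (τ φ : ℝ) where

    private
      D = dist s (location p)
      c′ = run c S
      y = position c
      y′ = position c′
      M = len y (path S)
      A = age c t
      B = age c′ τ + runCost c S

    0≤D : 0# ≤ D
    0≤D = dist-nonNeg s (location p)

    0≤M : 0# ≤ M
    0≤M = len-nonNeg y (path S)

    farthest-pending : t < arrival q → arrival q ≤ τ → D + t ≤ τ → D + (arrival q + arrival q) ≤ τ + τ →
      D ≤ dist s (location q) + dist s (location q) → q ∉ served c →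
      Timed t S τ → Credit c t s φ → Gain D φ 0# M A B
    farthest-pending t<aq aq≤τ D+t≤τ D+2aq≤2τ D≤2E q∉ tm cr with resolved? c′ q
    -- The witness waits at least `D / 2` within the phase, and this is counted four times.
    ... | no ¬rq = waited (waiting-gain c tm (aq≤τ , ¬rq) (proj₁ t<aq) ≤-refl) bound
      where
      bound : ∀ W → W + arrival q ≡ τ → D + 0# ≤ φ + quadruple (M + W)
      bound W refl = linear (D+2aq≤2τ +≤ D+2aq≤2τ +≤ 0≤D +≤ credit-nonNeg cr +≤ 0≤M +≤ 0≤M +≤ 0≤M +≤ 0≤M)
        (solve 5 (λ D W a φ M → D :+ con 0 :+ (W :+ a :+ (W :+ a) :+ (W :+ a :+ (W :+ a)) :+ D :+ φ :+ M
            :+ M :+ M :+ M)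
            := φ :+ :4 (M :+ W) :+ (D :+ (a :+ a) :+ (D :+ (a :+ a)) :+ con 0 :+ con 0 :+ con 0 :+ con 0
                :+ con 0 :+ con 0))
          refl D W (arrival q) φ M)
    ... | yes rq with cr
    -- With `E` the distance from `s` to `q`, `D ≤ 2E ≤ 2 dist y s + 2 dist y (location
    -- q)`; the potential pays the first term and `2M` the second.
    ...   | near 2d≤φ = moved (movement-gain c tm)
      (linear (D≤2E +≤ triangle +≤ triangle +≤ 2d≤φ +≤ visit +≤ visit +≤ 0≤M +≤ 0≤M +≤ 0≤e′ +≤ 0≤e′)
        (solve 7 (λ D E d e e′ φ M →
            D :+ con 0 :+ (E :+ E :+ (d :+ e) :+ (d :+ e) :+ φ :+ M :+ M :+ M :+ M :+ e′ :+ e′)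
            := φ :+ :4 M :+ (D :+ E :+ E :+ (d :+ d) :+ (e :+ e′) :+ (e :+ e′) :+ con 0 :+ con 0 :+ con 0
                :+ con 0))
          refl D (dist s (location q)) (dist y s) (dist y (location q)) (dist (location q) y′) φ M))
      where
      visit = resolved-visit c S q∉ rq
      0≤e′ = dist-nonNeg (location q) y′
      triangle : dist s (location q) ≤ dist y s + dist y (location q)
      triangle = subst (λ d → dist s (location q) ≤ d + dist y (location q)) (dist-sym s y) (dist-triangle s y (location q))
    ...   | owed p₀ (ap₀≤t , ¬r₀) refl 0≤φ with resolved? c′ p₀
    -- The earlier ghost `p₀` waits from `t` to `τ`, which is at least `D`.
    ...     | no ¬rp₀ = waited (waiting-gain c tm (≤-trans ap₀≤t (timed-≤ tm) , ¬rp₀) ≤-refl ap₀≤t) bound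
      where
      bound : ∀ W → W + t ≡ τ → D + 0# ≤ φ + quadruple (M + W)
      bound W refl = linear (D+t≤τ +≤ D+t≤τ +≤ D+t≤τ +≤ D+t≤τ +≤ 0≤D +≤ 0≤D +≤ 0≤D +≤ 0≤φ +≤ 0≤M +≤ 0≤M
          +≤ 0≤M +≤ 0≤M)
        (solve 5 (λ D W t φ M → D :+ con 0 :+ (W :+ t :+ (W :+ t) :+ (W :+ t) :+ (W :+ t) :+ D :+ D :+ D
            :+ φ :+ M :+ M :+ M :+ M)
            := φ :+ :4 (M :+ W) :+ (D :+ t :+ (D :+ t) :+ (D :+ t) :+ (D :+ t) :+ con 0 :+ con 0 :+ con 0
                :+ con 0 :+ con 0 :+ con 0 :+ con 0 :+ con 0))
          refl D W t φ M)
    -- The server visits both `s` and `q`. Adding the triangle inequalities through its first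
    -- position `y` and its last position `y′` gives `2E ≤ 2M`.
    ...     | yes rp₀ = moved (movement-gain c tm)
      (linear (D≤2E +≤ before +≤ after +≤ visit +≤ visit₀ +≤ 0≤φ +≤ 0≤M +≤ 0≤M)
        (solve 8 (λ D E ys ye sy ey φ M →
            D :+ con 0 :+ (E :+ E :+ (ys :+ ye) :+ (sy :+ ey) :+ M :+ M :+ φ :+ M :+ M)
            := φ :+ :4 M :+ (D :+ E :+ E :+ (ye :+ ey) :+ (ys :+ sy) :+ con 0 :+ con 0 :+ con 0))
          refl D (dist s (location q)) (dist y s) (dist y (location q)) (dist s y′) (dist (location q) y′) φ M))
      where
      visit = resolved-visit c S q∉ rq
      visit₀ = resolved-visit c S (¬r₀ ∘ inj₁) rp₀
      before : dist s (location q) ≤ dist y s + dist y (location q)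
      before = subst (λ d → dist s (location q) ≤ d + dist y (location q)) (dist-sym s y) (dist-triangle s y (location q))
      after : dist s (location q) ≤ dist s y′ + dist (location q) y′
      after = subst (λ d → dist s (location q) ≤ dist s y′ + d) (dist-sym y′ (location q)) (dist-triangle s y′ (location q))

    -- Besides `D`, the new potential `2d′` has to be built up; the visit to `p` supplies
    -- `e + d′ ≤ M`.
    farthest-served : D + t ≤ τ → p ∉ served c → Resolved c′ p → Timed t S τ → Credit c t s φ →
      Gain D φ (dist y′ (location p) + dist y′ (location p)) M A B
    farthest-served D+t≤τ p∉ rp tm cr = subst (λ d′
        → Gain D φ (d′ + d′) M A B) (dist-sym (location p) y′) (cases cr)
      where
      d′ = dist (location p) y′
      e = dist y (location p)
      visit : e + d′ ≤ M
      visit = resolved-visit c S p∉ rp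
      0≤e = dist-nonNeg y (location p)
      0≤d′ = dist-nonNeg (location p) y′
      before : D ≤ dist y s + e
      before = subst (λ d → D ≤ d + e) (dist-sym s y) (dist-triangle s y (location p))
      after : D ≤ dist s y′ + d′
      after = subst (λ d → D ≤ dist s y′ + d) (dist-sym y′ (location p)) (dist-triangle s y′ (location p))
      cases : Credit c t s φ → Gain D φ (d′ + d′) M A B
      -- `D ≤ dist y s + e`, so `D + 2d′ ≤ φ + 2M`.
      cases (near 2d≤φ) = moved (movement-gain c tm)
        (linear (before +≤ visit +≤ visit +≤ 2d≤φ +≤ 0≤e +≤ dist-nonNeg y s +≤ 0≤M +≤ 0≤M)
          (solve 6 (λ D d e d′ φ M → D :+ (d′ :+ d′) :+ (d :+ e :+ M :+ M :+ φ :+ e :+ d :+ M :+ M)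
              := φ :+ :4 M :+ (D :+ (e :+ d′) :+ (e :+ d′) :+ (d :+ d) :+ con 0 :+ con 0 :+ con 0 :+ con 0))
            refl D (dist y s) e d′ φ M))
      cases (owed p₀ (ap₀≤t , ¬r₀) refl 0≤φ) with resolved? c′ p₀
      -- The wait for `p₀` pays `D`, and the movement pays `2d′ ≤ 2M`.
      ... | no ¬rp₀ = waited (waiting-gain c tm (≤-trans ap₀≤t (timed-≤ tm) , ¬rp₀) ≤-refl ap₀≤t) bound
        where
        bound : ∀ W → W + t ≡ τ → D + (d′ + d′) ≤ φ + quadruple (M + W)
        bound W refl = linear (D+t≤τ +≤ D+t≤τ +≤ D+t≤τ +≤ D+t≤τ +≤ 0≤D +≤ 0≤D +≤ 0≤D +≤ 0≤φ +≤ visit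
            +≤ visit +≤ 0≤M +≤ 0≤M +≤ 0≤e +≤ 0≤e)
          (solve 7 (λ D W t φ M d′ e → D :+ (d′ :+ d′) :+ (W :+ t :+ (W :+ t) :+ (W :+ t) :+ (W :+ t) :+ D
              :+ D :+ D :+ φ :+ M :+ M :+ M :+ M :+ e :+ e)
              := φ :+ :4 (M :+ W) :+ (D :+ t :+ (D :+ t) :+ (D :+ t) :+ (D :+ t) :+ con 0 :+ con 0 :+ con 0
                  :+ con 0 :+ (e :+ d′) :+ (e :+ d′) :+ con 0 :+ con 0 :+ con 0 :+ con 0))
            refl D W t φ M d′ e)
      -- The server visits both `s` and `p`. Averaging the bounds on `D` through `y` and through
      -- `y′` gives `D ≤ M`, hence `D + 2d′ ≤ 3M`; the average is the reason for doubling the claim.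
      ... | yes rp₀ = moved (movement-gain c tm)
        (halve (linear (before +≤ after +≤ visit +≤ visit₀ +≤ (visit +≤ visit +≤ visit +≤ visit) +≤ 0≤φ
            +≤ 0≤φ +≤ 0≤M +≤ 0≤M +≤ (0≤e +≤ 0≤e +≤ 0≤e +≤ 0≤e))
          (solve 7 (λ D ys e sy d′ φ M →
              D :+ (d′ :+ d′) :+ (D :+ (d′ :+ d′)) :+ (ys :+ e :+ (sy :+ d′) :+ M :+ M :+ (M :+ M :+ M :+ M)
                  :+ φ :+ φ :+ M :+ M :+ (e :+ e :+ e :+ e))
              := φ :+ :4 M :+ (φ :+ :4 M) :+ (D :+ D :+ (e :+ d′) :+ (ys :+ sy) :+ (e :+ d′ :+ (e :+ d′)
                  :+ (e :+ d′) :+ (e :+ d′)) :+ con 0 :+ con 0 :+ con 0 :+ con 0 :+ (con 0 :+ con 0 :+ con 0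
                  :+ con 0)))
            refl D (dist y s) e (dist s y′) d′ φ M)))
        where
        visit₀ = resolved-visit c S (¬r₀ ∘ inj₁) rp₀

  -- The age at `t` stands on the left because earlier phases have already spent it, so the
  -- remaining cost must also cover it. At the end of a feasible schedule nothing is pending and the
  -- age is 0, which closes the induction over the phases.
  offline-bound : ∀ {t s total φ} c S → Phases t s total → Credit c t s φ → Sorted t S →
    (∀ {q} → q ∈ served c → arrival q ≤ t) → (∀ q → Resolved (run c S) q) →
    total + quadruple (age c t) ≤ φ + quadruple (runCost c S)
  offline-bound {t} {φ = φ} c S [] cr st arrived feasible with timed-total S st
  ... | τ , tm = linear (credit-nonNeg cr +≤ g +≤ g +≤ g +≤ g)
        (solve 3 (λ φ A K → con 0 :+ :4 A :+ (φ :+ K :+ K :+ K :+ K)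
            := φ :+ :4 K :+ (con 0 :+ A :+ A :+ A :+ A)) refl φ (age c t) (runCost c S))
    where
    age≡0 : age (run c S) τ ≤ 0#
    age≡0 = subst (_≤ 0#) (+-identityʳ _) (age-≤ (run c S) τ ≤-refl (λ {q} (_ , ¬r)
        → contradiction (feasible q) ¬r))
    g : age c t ≤ runCost c S
    g = linear (movement-gain c tm +≤ age≡0 +≤ len-nonNeg (position c) (path S))
      (solve 4 (λ A K A′ M → A :+ (A′ :+ K :+ con 0 :+ M) := K :+ (A :+ M :+ A′ :+ con 0)) refl
        (age c t) (runCost c S) (age (run c S) τ) (len (position c) (path S)))
  offline-bound {t} {s} {φ = φ} c S (extend {total = total} p q τ t<ap ap≤τ t<aq aq≤τ D+t≤τ D+2aq≤2τ D≤2E ps) cr st arrived feasible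
    with timed-split S τ st (≤-trans (proj₁ t<ap) ap≤τ)
  ... | S₁ , S₂ , refl , tm , st₂ = combine step
    where
    D = dist s (location p)
    c′ = run c S₁
    fresh : ∀ {z} → t < arrival z → z ∉ served c
    fresh t<az z∈ = <⇒≱ t<az (arrived z∈)
    step : ∃[ φ′ ] Credit c′ τ (location p) φ′ ×
             Gain D φ φ′ (len (position c) (path S₁)) (age c t) (age c′ τ + runCost c S₁)
    step with resolved? c′ p
    ... | yes r = _ , near ≤-refl , farthest-served c S₁ p q τ φ D+t≤τ (fresh t<ap) r tm cr
    ... | no ¬r = 0# , owed p (ap≤τ , ¬r) refl ≤-refl ,
                  farthest-pending c S₁ p q τ φ t<aq aq≤τ D+t≤τ D+2aq≤2τ D≤2E (fresh t<aq) tm cr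
    combine : (∃[ φ′ ] Credit c′ τ (location p) φ′ ×
             Gain D φ φ′ (len (position c) (path S₁)) (age c t) (age c′ τ + runCost c S₁)) →
             D + total + quadruple (age c t) ≤ φ + quadruple (runCost c (S₁ ++ S₂))
    combine (φ′ , cr′ , gain) = subst (λ k
        → D + total + quadruple (age c t) ≤ φ + quadruple k) (sym (runCost-++ c S₁ S₂))
      (linear (settle gain +≤ offline-bound c′ S₂ ps cr′ st₂ (served-arrived c tm arrived)
                (λ z → subst (λ c″ → Resolved c″ z) (run-++ c S₁ S₂) (feasible z)))
        (solve 8 (λ D T A A′ φ φ′ K K₂ → D :+ T :+ :4 A :+ (φ :+ :4 (A′ :+ K) :+ (φ′ :+ :4 K₂))
            := φ :+ :4 (K :+ K₂) :+ (D :+ φ′ :+ :4 A :+ (T :+ :4 A′))) refl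
          D total (age c t) (age c′ τ) φ φ′ (runCost c S₁) (runCost c′ S₂)))

-- The analysis is carried out for an abstract sequence of radii because the
-- minimum that defines δ is expensive to unfold.
record DoublingRadii (R : RealNumbers) (X : FiniteSubset R) : Set where
  open RealNumbers R
  open Geometry R X
  field
    r         : ℕ → ℝ
    r-nonNeg  : ∀ j → 0# ≤ r j
    r-suc     : ∀ j → r (suc j) ≡ r j + r j
    r-zero    : ∀ {u v} → u ≢ v → r 0 ≤ dist u v
    lastIndex : ℕ
    r-last    : ∀ u v → dist u v ≤ r lastIndex

dyadicRadii : (R : RealNumbers) (X : FiniteSubset R) → DoublingRadii R X
dyadicRadii R X = record
  { r         = radius
  ; r-nonNeg  = radius-nonNeg
  ; r-suc     = radius-suc
  ; r-zero    = radius-zero-≤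
  ; lastIndex = proj₁ radius-unbounded
  ; r-last    = proj₂ radius-unbounded
  }
  where
  open Geometry R X
  open GeometryProperties R X

-- Cost of a run, measured by the displacements of the anchor.

module ExplorationBound (R : RealNumbers) (X : FiniteSubset R) (s₀ : FiniteSubset.Site X) (I : Input R X)
                        (radii : DoublingRadii R X) where
  open RealNumbers R
  open Geometry R X
  open DoublingRadii radii
  open OrderedFieldProperties R
  open FiniteSubset X
  open GeometryProperties R X
  open Input I
  open Service R X s₀ I
  open ServiceProperties R X s₀ I
  open OfflineBound R X s₀ I
  open Server
  open Exploration r
  open Ghost
  -- `n ×′ 1#` is the form in which the solver reads `con n`; the numerals of the cost bound keep it
  -- and are converted to `fromℕ` only in the final inequality.
  open NumeralMult semiring using () renaming (_×_ to _×′_)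
  open Data.List.Extrema totalOrder using (max≤v⁺; argmin-sel; min≤⊤; min≤xs)
  open DecMembership (Fin._≟_ {size}) using () renaming (_∈?_ to _∈ₛ?_)

  ghosts : List⁺ Ghost → List Ghost
  ghosts = List⁺.toList

  born : Ghost → ℝ
  born g = arrival (identity g)

  place : Ghost → Site
  place g = location (identity g)

  discovered? : ∀ (g : Ghost) → Dec (Is-just (revealed g))
  discovered? (ghost _ (just _)) = yes (just tt)
  discovered? (ghost _ nothing)  = no (λ ())

  oldest-≤ : ∀ G {g} → g ∈ ghosts G → oldest G ≤ born g
  oldest-≤ (g ∷ gs) (here refl) = min≤⊤ (born g) (map born gs)
  oldest-≤ (g ∷ gs) (there g∈)  = All.lookup (min≤xs (born g) (map born gs)) (∈-map⁺ born g∈)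

  oldest-attained : ∀ G → ∃[ g ] g ∈ ghosts G × oldest G ≡ born g
  oldest-attained (g ∷ gs) with argmin-sel id (born g) (map born gs)
  ... | inj₁ eq  = g , here refl , eq
  ... | inj₂ min∈ with ∈-map⁻ born min∈
  ...   | h , h∈ , eq = h , there h∈ , eq

  oldest-unique : ∀ G {a g} → g ∈ ghosts G → born g ≡ a → (∀ {h} → h ∈ ghosts G → a ≤ born h) → oldest G ≡ a
  oldest-unique G g∈ refl h with oldest-attained G
  ... | g′ , g′∈ , eq = ≤-antisym (oldest-≤ G g∈) (subst (_ ≤_) (sym eq) (h g′∈))

  reveal-identity : ∀ vs g → identity (reveal vs g) ≡ identity g
  reveal-identity vs g with place g ∈ₛ? vs
  ... | yes _ = refl
  ... | no  _ = refl

  reveal-known : ∀ vs g {x} → revealed (reveal vs g) ≡ just x → (x ≡ place g × x ∈ vs) ⊎ revealed g ≡ just x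
  reveal-known vs g eq with place g ∈ₛ? vs
  ... | yes ∈vs = inj₁ (sym (just-injective eq) , subst (_∈ vs) (just-injective eq) ∈vs)
  ... | no  _   = inj₂ eq

  reveal-visited : ∀ vs g → place g ∈ vs → Is-just (revealed (reveal vs g))
  reveal-visited vs g ∈vs with place g ∈ₛ? vs
  ... | yes _   = just tt
  ... | no  ∉vs = contradiction ∈vs ∉vs

  reveal-missed : ∀ vs g → place g ∉ vs → reveal vs g ≡ g
  reveal-missed vs g ∉vs with place g ∈ₛ? vs
  ... | yes ∈vs = contradiction ∈vs ∉vs
  ... | no  _   = refl

  ∈-reveal⁻ : ∀ vs G {h} → h ∈ ghosts (List⁺.map (reveal vs) G) → ∃[ g ] g ∈ ghosts G × h ≡ reveal vs g
  ∈-reveal⁻ vs G = ∈-map⁻ (reveal vs) {xs = ghosts G}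

  ∈-reveal⁺ : ∀ vs G {g} → g ∈ ghosts G → reveal vs g ∈ ghosts (List⁺.map (reveal vs) G)
  ∈-reveal⁺ vs G = ∈-map⁺ (reveal vs) {xs = ghosts G}

  oldest-reveal : ∀ vs G → oldest (List⁺.map (reveal vs) G) ≡ oldest G
  oldest-reveal vs G = oldest-unique (List⁺.map (reveal vs) G) (∈-reveal⁺ vs G g∈)
    (trans (cong arrival (reveal-identity vs g)) (sym eq)) later-born
    where
    g  = proj₁ (oldest-attained G)
    g∈ = proj₁ (proj₂ (oldest-attained G))
    eq = proj₂ (proj₂ (oldest-attained G))
    later-born : ∀ {h} → h ∈ ghosts (List⁺.map (reveal vs) G) → oldest G ≤ born h
    later-born h∈ with ∈-reveal⁻ vs G h∈
    ... | h′ , h′∈ , refl = subst (oldest G ≤_) (cong arrival (sym (reveal-identity vs h′))) (oldest-≤ G h′∈)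

  oldest-⁺++ : ∀ G hs → (∀ {g h} → g ∈ ghosts G → h ∈ hs → born g ≤ born h) → oldest (G ⁺++ hs) ≡ oldest G
  oldest-⁺++ G hs G≤hs with oldest-attained G
  ... | g , g∈ , eq = oldest-unique (G ⁺++ hs) (∈-++⁺ˡ g∈) (sym eq)
          (λ h∈ → [ oldest-≤ G , (λ h∈hs → subst (_≤ _) (sym eq) (G≤hs g∈ h∈hs)) ]′ (∈-++⁻ (ghosts G) h∈))

  ∈-newGhosts⁻ : ∀ {s t U g} → g ∈ newGhosts s t U →
    (revealed g ≡ nothing × identity g ∈ U) × (born g ≡ t × place g ≢ s)
  ∈-newGhosts⁻ {s} {t} {U} g∈ with ∈-map⁻ (λ q → ghost q nothing) g∈
  ... | q , q∈ , refl with ∈-filter⁻ _ {xs = U} q∈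
  ...   | q∈U , p = (refl , q∈U) , p

  ∈-later⁻ : ∀ {t U q} → q ∈ later t U → q ∈ U × arrival q ≢ t
  ∈-later⁻ {t} {U} q∈ = ∈-filter⁻ _ {xs = U} q∈

  epoch-split : ∀ s t U {q} → q ∈ U →
    q ∈ later t U ⊎ (arrival q ≡ t × location q ≡ s) ⊎ (arrival q ≡ t × ghost q nothing ∈ newGhosts s t U)
  epoch-split s t U {q} q∈U with arrival q ≟ t | location q Fin.≟ s
  ... | no  a≢t | _       = inj₁ (∈-filter⁺ _ q∈U a≢t)
  ... | yes a≡t | yes q≡s = inj₂ (inj₁ (a≡t , q≡s))
  ... | yes a≡t | no  q≢s = inj₂ (inj₂ (a≡t , ∈-map⁺ (λ q → ghost q nothing) (∈-filter⁺ _ q∈U (a≡t , q≢s))))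

  -- `t` is the end of the previous phase, or a time before every arrival. The state `c` is that
  -- after the last action, so epochs resolved at the anchor leave it unchanged. The comparison of
  -- arrivals ensures that these requests have arrived by the next sweep, whose `await` then records
  -- them.
  record IdleInvariant (t : ℝ) (s : Site) (U : List Request) (c : Server) : Set where
    field
      anchored : position c ≡ s
      upcoming : ∀ {u} → u ∈ U → t < arrival u
      covered  : ∀ q → q ∈ U ⊎ (Resolved c q × (∀ {u} → u ∈ U → arrival q ≤ arrival u))

  -- The field `witness` is the ghost `q` of `Phases` in preparation, with halves cleared. Before
  -- the first sweep any initial ghost serves: it is not at the anchor, hence at distance at least
  -- `r 0`, and it is as old as the oldest.
  record PhaseInvariant (t : ℝ) (s : Site) (j : ℕ) (G : List⁺ Ghost) (U : List Request) (c : Server) : Set where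
    field
      anchored : position c ≡ s
      started  : t < oldest G
      covered  : ∀ q → q ∈ U ⊎ (Resolved c q × arrival q ≤ sweepTime j G)
                       ⊎ (∃[ g ] g ∈ ghosts G × identity g ≡ q × revealed g ≡ nothing)
      known    : ∀ {g x} → g ∈ ghosts G → revealed g ≡ just x → x ≡ place g × dist s x ≤ r j
      arrived  : ∀ {g} → g ∈ ghosts G → born g ≤ sweepTime j G
      upcoming : ∀ {g u} → g ∈ ghosts G → u ∈ U → born g ≤ arrival u
      witness  : ∃[ g ] g ∈ ghosts G × r j ≤ dist s (place g) + dist s (place g)
                       × born g + born g ≤ oldest G + oldest G + r j

  -- Two times are kept because they differ inside a phase: `t` is where the last completed phase
  -- ended, while `l` bounds the next action from below. `spent` is what earlier sweeps of the
  -- current phase may have cost.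
  record Outcome (t : ℝ) (s : Site) (l : ℝ) (c : Server) (S : Schedule) (spent : ℝ) : Set where
    constructor outcome
    field
      total    : ℝ
      phases   : Phases t s total
      bounded  : spent + runCost c S ≤ (21 ×′ 1#) * total
      sorted   : Sorted l S
      complete : ∀ q → Resolved (run c S) q

  walkCost-≤ : ∀ t c w {L m} → len (position c) w ≤ L → 0# ≤ m → (∀ {q} → q ∈ hit t c w → t ≤ m + arrival q) →
               walkCost t c w ≤ L + m
  walkCost-≤ t c w len≤ 0≤m h = len≤ +≤ max≤v⁺ 0≤m (All.map⁺ (All.tabulate (x≤y+z⇒x-z≤y ∘ h)))

  -- Before the sweep of radius r_j, the sweeps of a phase have cost at most
  -- 5 (r_0 + ⋯ + r_{j-1}) ≤ 5 r_j.
  sweepBudget : ℕ → ℝ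
  sweepBudget j = (5 ×′ 1#) * r j

  start-invariant : ∀ {t₀ s t U g gs c} → IdleInvariant t₀ s U c → NextEpoch t U → newGhosts s t U ≡ g ∷ gs →
                    PhaseInvariant t₀ s 0 (g ∷ gs) (later t U) c
  start-invariant {t₀} {s} {t} {U} {g} {gs} {c} inv next@((u , u∈U , au≡t) , t≤U) eq = record
    { anchored = anchored
    ; started  = subst (t₀ <_) (trans au≡t (sym oldest≡t)) (upcoming u∈U)
    ; covered  = cover
    ; known    = λ g∈ rev → contradiction (trans (sym (proj₁ (proj₁ (new g∈)))) rev) (λ ())
    ; arrived  = λ g∈ → subst (_≤ sweepTime 0 G) (sym (born≡t g∈)) t≤sweep
    ; upcoming = λ g∈ u∈ → subst (_≤ _) (sym (born≡t g∈)) (All.lookup t≤U (proj₁ (∈-later⁻ {t} {U} u∈)))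
    ; witness  = g , here refl ,
        ≤-trans (r-zero (λ s≡g → proj₂ (proj₂ (new (here refl))) (sym s≡g))) (x≤x+y _ (dist-nonNeg s (place g))) ,
        ≤-trans (≤-reflexive (cong (λ a
            → a + a) (trans (born≡t (here refl)) (sym oldest≡t)))) (x≤x+y _ (r-nonNeg 0))
    }
    where
    open IdleInvariant inv
    G = g ∷ gs
    new : ∀ {h} → h ∈ ghosts G → (revealed h ≡ nothing × identity h ∈ U) × (born h ≡ t × place h ≢ s)
    new h∈ = ∈-newGhosts⁻ {s} {t} {U} (subst (_ ∈_) (sym eq) h∈)
    born≡t : ∀ {h} → h ∈ ghosts G → born h ≡ t
    born≡t h∈ = proj₁ (proj₂ (new h∈))
    oldest≡t : oldest G ≡ t
    oldest≡t = oldest-unique G (here refl) (born≡t (here refl)) (λ h∈ → ≤-reflexive (sym (born≡t h∈)))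
    t≤sweep : t ≤ sweepTime 0 G
    t≤sweep = subst (_≤ sweepTime 0 G) oldest≡t (x≤x+y (oldest G) (r-nonNeg 0))
    cover : ∀ q → q ∈ later t U ⊎ (Resolved c q × arrival q ≤ sweepTime 0 G)
                     ⊎ (∃[ h ] h ∈ ghosts G × identity h ≡ q × revealed h ≡ nothing)
    cover q with covered q
    ... | inj₂ (r , q≤U) = inj₂ (inj₁ (r , ≤-trans (q≤U u∈U) (subst (_≤ sweepTime 0 G) (sym au≡t) t≤sweep)))
    ... | inj₁ q∈U with epoch-split s t U q∈U
    ...   | inj₁ q∈later             = inj₁ q∈later
    ...   | inj₂ (inj₁ (a≡t , q≡s)) = inj₂ (inj₁ (inj₂ (trans q≡s (sym anchored)) , subst (_≤ sweepTime 0 G) (sym a≡t) t≤sweep))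
    ...   | inj₂ (inj₂ (_ , g∈))    = inj₂ (inj₂ (_ , subst (_ ∈_) eq g∈ , refl , refl))

  resolved-invariant : ∀ {t₀ s t U c} → IdleInvariant t₀ s U c → NextEpoch t U → newGhosts s t U ≡ [] →
                       IdleInvariant t₀ s (later t U) c
  resolved-invariant {t₀} {s} {t} {U} {c} inv (_ , t≤U) eq = record
    { anchored = anchored
    ; upcoming = λ u∈ → upcoming (proj₁ (∈-later⁻ {t} {U} u∈))
    ; covered  = cover
    }
    where
    open IdleInvariant inv
    cover : ∀ q → q ∈ later t U ⊎ (Resolved c q × (∀ {u} → u ∈ later t U → arrival q ≤ arrival u))
    cover q with covered q
    ... | inj₂ (r , q≤U) = inj₂ (r , λ u∈ → q≤U (proj₁ (∈-later⁻ {t} {U} u∈)))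
    ... | inj₁ q∈U with epoch-split s t U q∈U
    ...   | inj₁ q∈later             = inj₁ q∈later
    ...   | inj₂ (inj₁ (refl , q≡s)) = inj₂ (inj₂ (trans q≡s (sym anchored)) , λ u∈
        → All.lookup t≤U (proj₁ (∈-later⁻ {t} {U} u∈)))
    ...   | inj₂ (inj₂ (_ , g∈))     = contradiction (subst (_ ∈_) eq g∈) (λ ())

  -- Epochs are consumed in order of arrival, so ghosts joining a phase leave its sweep times
  -- unchanged.
  oldest-epoch : ∀ {t₀ s j t G U c} → PhaseInvariant t₀ s j G U c →
                 oldest (G ⁺++ newGhosts s t U) ≡ oldest G
  oldest-epoch {s = s} {t = t} {G = G} {U} inv = oldest-⁺++ G (newGhosts s t U)
    (λ g∈ h∈ → PhaseInvariant.upcoming inv g∈ (proj₂ (proj₁ (∈-newGhosts⁻ {s} {t} {U} h∈))))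

  epoch-invariant : ∀ {t₀ s j t G U c} → PhaseInvariant t₀ s j G U c → NextEpoch t U → t ≤ sweepTime j G →
                    PhaseInvariant t₀ s j (G ⁺++ newGhosts s t U) (later t U) c
  epoch-invariant {t₀} {s} {j} {t} {G} {U} {c} inv (_ , t≤U) t≤sweep = record
    { anchored = anchored
    ; started  = subst (t₀ <_) (sym oldest≡) started
    ; covered  = cover
    ; known    = λ g∈ rev → [ (λ g∈G → known g∈G rev)
                            , (λ g∈N → contradiction (trans (sym (proj₁ (proj₁ (∈-newGhosts⁻ {s} {t} {U} g∈N)))) rev) (λ ())) ]′
                            (∈-++⁻ (ghosts G) g∈)
    ; arrived  = λ g∈ → subst (λ a → _ ≤ a + r j) (sym oldest≡)
                   ([ arrived , (λ g∈N → subst (_≤ sweepTime j G) (sym (born≡t g∈N)) t≤sweep) ]′ (∈-++⁻ (ghosts G) g∈))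
    ; upcoming = λ g∈ u∈ → let u∈U = proj₁ (∈-later⁻ {t} {U} u∈) in
                   [ (λ g∈G → upcoming g∈G u∈U)
                   , (λ g∈N → subst (_≤ _) (sym (born≡t g∈N)) (All.lookup t≤U u∈U)) ]′ (∈-++⁻ (ghosts G) g∈)
    ; witness  = let (g , g∈ , r≤ , a≤) = witness in
                   g , ∈-++⁺ˡ g∈ , r≤ , subst (λ a → born g + born g ≤ a + a + r j) (sym oldest≡) a≤
    }
    where
    open PhaseInvariant inv
    N = newGhosts s t U
    born≡t : ∀ {g} → g ∈ N → born g ≡ t
    born≡t g∈ = proj₁ (proj₂ (∈-newGhosts⁻ {s} {t} {U} g∈))
    oldest≡ : oldest (G ⁺++ N) ≡ oldest G
    oldest≡ = oldest-epoch inv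
    in-time : ∀ {a} → a ≤ sweepTime j G → a ≤ sweepTime j (G ⁺++ N)
    in-time = subst (λ a → _ ≤ a + r j) (sym oldest≡)
    cover : ∀ q → q ∈ later t U ⊎ (Resolved c q × arrival q ≤ sweepTime j (G ⁺++ N))
                     ⊎ (∃[ h ] h ∈ ghosts (G ⁺++ N) × identity h ≡ q × revealed h ≡ nothing)
    cover q with covered q
    ... | inj₂ (inj₁ (r , a≤))            = inj₂ (inj₁ (r , in-time a≤))
    ... | inj₂ (inj₂ (g , g∈ , id≡ , hid)) = inj₂ (inj₂ (g , ∈-++⁺ˡ g∈ , id≡ , hid))
    ... | inj₁ q∈U with epoch-split s t U q∈U
    ...   | inj₁ q∈later             = inj₁ q∈later
    ...   | inj₂ (inj₁ (refl , q≡s)) = inj₂ (inj₁ (inj₂ (trans q≡s (sym anchored)) , in-time t≤sweep))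
    ...   | inj₂ (inj₂ (_ , g∈))     = inj₂ (inj₂ (_ , ∈-++⁺ʳ (ghosts G) g∈ , refl , refl))

  -- The sweep w and, below, the final move m are abstract for the same reason
  -- as the radii.
  module Sweep {t₀ s j G U c} (inv : PhaseInvariant t₀ s j G U c)
               (none : All (λ q → sweepTime j G < arrival q) U)
               (w : List Site) (w-end : end s w ≡ s) (w-len : len s w ≤ r j + r j + (r j + r j))
               (w-within : ∀ {v} → v ∈ s ∷ w → dist s v ≤ r j)
               (w-covers : ∀ {v} → dist s v ≤ r j → v ∈ s ∷ w) where
    open PhaseInvariant inv

    private
      τ  = sweepTime j G
      vs : List Site
      vs = s ∷ w
      G′ = List⁺.map (reveal vs) G

    swept : Server
    swept = walk τ (await τ c) w

    swept-anchored : position swept ≡ s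
    swept-anchored = trans (cong (λ u → end u w) anchored) w-end

    settled-served : ∀ {q} → Resolved c q → arrival q ≤ τ → q ∈ served (await τ c)
    settled-served (inj₁ q∈) _   = ∈-++⁺ʳ (filter _ requests) q∈
    settled-served (inj₂ q≡) a≤τ = ∈-await⁺ {τ} {c} a≤τ q≡

    ghost-served : ∀ {g} → g ∈ ghosts G → place g ∈ vs → identity g ∈ served swept
    ghost-served g∈ ∈vs = ∈-walk⁺ {τ} {await τ c} {w} (arrived g∈)
      (subst (λ u → _ ∈ u ∷ w) (sym anchored) ∈vs)

    swept-covered : ∀ q → q ∈ U ⊎ (q ∈ served swept × arrival q ≤ τ)
                      ⊎ (∃[ g ] g ∈ ghosts G × identity g ≡ q × revealed g ≡ nothing × place g ∉ vs)
    swept-covered q with covered q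
    ... | inj₁ q∈U              = inj₁ q∈U
    ... | inj₂ (inj₁ (res , a≤τ)) = inj₂ (inj₁ (∈-++⁺ʳ (hit τ (await τ c) w) (settled-served res a≤τ) , a≤τ))
    ... | inj₂ (inj₂ (g , g∈ , refl , hid)) with place g ∈ₛ? vs
    ...   | yes ∈vs = inj₂ (inj₁ (ghost-served g∈ ∈vs , arrived g∈))
    ...   | no  ∉vs = inj₂ (inj₂ (g , g∈ , refl , hid , ∉vs))

    sweepCost : ℝ
    sweepCost = walkCost τ (await τ c) w

    -- The length is at most `4 r_j`. Among the arrived requests, those settled before the sweep are
    -- recorded by `await`, so whatever is hit is a ghost, born no earlier than
    -- `oldest G = τ - r_j`; the delay adds at most `r_j`.
    sweep-cost : sweepCost ≤ r j + r j + (r j + r j) + r j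
    sweep-cost = walkCost-≤ τ (await τ c) w
      (subst (λ u → len u w ≤ r j + r j + (r j + r j)) (sym anchored) w-len)
      (r-nonNeg j) delay
      where
      delay : ∀ {q} → q ∈ hit τ (await τ c) w → τ ≤ r j + arrival q
      delay {q} q∈ with ∈-hit⁻ {τ} {await τ c} {w} q∈ | covered q
      ... | (a≤τ , q∉) , _ | inj₁ q∈U             = contradiction a≤τ (<⇒≱ (All.lookup none q∈U))
      ... | (a≤τ , q∉) , _ | inj₂ (inj₁ (res , _)) = contradiction (settled-served res a≤τ) q∉
      ... | (a≤τ , q∉) , _ | inj₂ (inj₂ (g , g∈ , refl , _)) =
            subst (τ ≤_) (+-comm (born g) (r j)) (oldest-≤ G g∈ +≤ ≤-refl)

    known-afterSweep : ∀ {g x} → g ∈ ghosts G → revealed (reveal vs g) ≡ just x → x ≡ place g × dist s x ≤ r j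
    known-afterSweep {g} g∈ rev with reveal-known vs g rev
    ... | inj₁ (x≡ , x∈) = x≡ , w-within x∈
    ... | inj₂ rev′      = known g∈ rev′

    r-grows : r j ≤ r (suc j)
    r-grows = subst (r j ≤_) (sym (r-suc j)) (x≤x+y (r j) (r-nonNeg j))

    τ-grows : τ ≤ sweepTime (suc j) G′
    τ-grows = subst (λ a → τ ≤ a + r (suc j)) (sym (oldest-reveal vs G)) (≤-refl +≤ r-grows)

    continue-invariant : ¬ AllDiscovered G′ → PhaseInvariant t₀ s (suc j) G′ U swept
    continue-invariant ¬all = record
      { anchored = swept-anchored
      ; started  = subst (t₀ <_) (sym (oldest-reveal vs G)) started
      ; covered  = cover
      ; known    = know
      ; arrived  = λ h∈ → let (g , g∈ , eq) = ∈-reveal⁻ vs G h∈ in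
                     subst (_≤ sweepTime (suc j) G′) (born≡ eq) (≤-trans (arrived g∈) τ-grows)
      ; upcoming = λ {_} {u} h∈ u∈ → let (g , g∈ , eq) = ∈-reveal⁻ vs G h∈ in
                     subst (_≤ arrival u) (born≡ eq) (upcoming g∈ u∈)
      ; witness  = missed
      }
      where
      born≡ : ∀ {g h} → h ≡ reveal vs g → born g ≡ born h
      born≡ {g} refl = cong arrival (sym (reveal-identity vs g))
      cover : ∀ q → q ∈ U ⊎ (Resolved swept q × arrival q ≤ sweepTime (suc j) G′)
                       ⊎ (∃[ g ] g ∈ ghosts G′ × identity g ≡ q × revealed g ≡ nothing)
      cover q with swept-covered q
      ... | inj₁ q∈U              = inj₁ q∈U
      ... | inj₂ (inj₁ (q∈ , a≤τ)) = inj₂ (inj₁ (inj₁ q∈ , ≤-trans a≤τ τ-grows))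
      ... | inj₂ (inj₂ (g , g∈ , refl , hid , ∉vs)) =
            inj₂ (inj₂ (g , subst (_∈ ghosts G′) (reveal-missed vs g ∉vs) (∈-reveal⁺ vs G g∈) , refl , hid))
      know : ∀ {h x} → h ∈ ghosts G′ → revealed h ≡ just x → x ≡ place h × dist s x ≤ r (suc j)
      know h∈ rev =
        let (g , g∈ , eq)  = ∈-reveal⁻ vs G h∈
            (x≡ , sx≤r) = known-afterSweep g∈ (trans (cong revealed (sym eq)) rev)
        in trans x≡ (cong location (trans (sym (reveal-identity vs g)) (cong identity (sym eq)))) , ≤-trans sx≤r r-grows
      far : ∀ {g} → place g ∉ vs → r j ≤ dist s (place g)
      far {g} ∉vs with ≤-total (r j) (dist s (place g))
      ... | inj₁ r≤ = r≤
      ... | inj₂ ≤r = contradiction (w-covers ≤r) ∉vs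
      missed : ∃[ h ] h ∈ ghosts G′ × r (suc j) ≤ dist s (place h) + dist s (place h)
                      × born h + born h ≤ oldest G′ + oldest G′ + r (suc j)
      -- A ghost missed by the sweep is at distance at least `r_j`, half of the next radius, and was
      -- born by `τ = oldest G + r_j`. It becomes the witness for the next sweep.
      missed with find (All.¬All⇒Any¬ discovered? (ghosts G′) ¬all)
      ... | h , h∈ , ¬disc with ∈-reveal⁻ vs G h∈
      ...   | g , g∈ , refl =
        g , subst (_∈ ghosts G′) (reveal-missed vs g ∉vs) h∈ ,
        subst (_≤ dist s (place g) + dist s (place g)) (sym (r-suc j)) (far {g} ∉vs +≤ far {g} ∉vs) ,
        subst₂ (λ a ρ → born g + born g ≤ a + a + ρ) (sym (oldest-reveal vs G)) (sym (r-suc j))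
          (linear (arrived g∈ +≤ arrived g∈)
            (solve 3 (λ b a ρ → b :+ b :+ (a :+ ρ :+ (a :+ ρ)) := a :+ a :+ (ρ :+ ρ) :+ (b :+ b)) refl
              (born g) (oldest G) (r j)))
        where
        ∉vs : place g ∉ vs
        ∉vs = ¬disc ∘ reveal-visited vs g

    -- The old budget `5 r_j` and at most `5 r_j` for this sweep add up to the next budget, since
    -- the radius doubles.
    continue-outcome : ∀ {l S} → Outcome t₀ s τ swept S (sweepBudget (suc j)) → l ≤ τ →
                       Outcome t₀ s l c ((at τ perform (w ∷ [])) ∷ S) (sweepBudget j)
    continue-outcome {S = S} (outcome total ps cost≤ sorted complete) l≤τ = outcome total ps
      (linear (subst (λ ρ → (5 ×′ 1#) * ρ + runCost swept S ≤ (21 ×′ 1#) * total) (r-suc j) cost≤ +≤ sweep-cost)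
        (solve 4 (λ ρ k K T → con 5 :* ρ :+ (k :+ con 0 :+ K) :+ (con 21 :* T :+ (ρ :+ ρ :+ (ρ :+ ρ) :+ ρ))
           := con 21 :* T :+ (con 5 :* (ρ :+ ρ) :+ K :+ k)) refl (r j) sweepCost (runCost swept S) total))
      (l≤τ ∷ sorted) complete

    module Move (disc : AllDiscovered G′) (x : Site) (m : List Site) (m-end : end s m ≡ x) (m-len : len s m ≡ dist s x) where

      all-served : ∀ q → q ∈ U ⊎ (q ∈ served swept × arrival q ≤ τ)
      all-served q with swept-covered q
      ... | inj₁ q∈U     = inj₁ q∈U
      ... | inj₂ (inj₁ p) = inj₂ p
      ... | inj₂ (inj₂ (g , g∈ , _ , hid , ∉vs)) = contradiction
            (subst Is-just hid (subst (Is-just ∘ revealed) (reveal-missed vs g ∉vs) (All.lookup disc (∈-reveal⁺ vs G g∈))))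
            (λ ())

      final : Server
      final = walk τ swept m

      moveCost : ℝ
      moveCost = walkCost τ swept m

      -- After a sweep that leaves no ghost undiscovered, every request that has arrived is served.
      -- The final move serves nothing and is charged for its length only.
      move-cost : moveCost ≤ dist s x + 0#
      move-cost = walkCost-≤ τ swept m
        (≤-reflexive (trans (cong (λ u → len u m) swept-anchored) m-len)) ≤-refl delay
        where
        delay : ∀ {q} → q ∈ hit τ swept m → τ ≤ 0# + arrival q
        delay {q} q∈ with ∈-hit⁻ {τ} {swept} {m} q∈ | all-served q
        ... | (a≤τ , q∉) , _ | inj₁ q∈U      = contradiction a≤τ (<⇒≱ (All.lookup none q∈U))
        ... | (a≤τ , q∉) , _ | inj₂ (q∈ , _) = contradiction q∈ q∉

      end-invariant : IdleInvariant τ x U final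
      end-invariant = record
        { anchored = trans (cong (λ u → end u m) swept-anchored) m-end
        ; upcoming = All.lookup none
        ; covered  = cover
        }
        where
        cover : ∀ q → q ∈ U ⊎ (Resolved final q × (∀ {u} → u ∈ U → arrival q ≤ arrival u))
        cover q with all-served q
        ... | inj₁ q∈U       = inj₁ q∈U
        ... | inj₂ (q∈ , a≤τ) = inj₂ (inj₁ (∈-++⁺ʳ (hit τ swept m) q∈) , λ u∈
            → ≤-trans a≤τ (proj₁ (All.lookup none u∈)))

      -- `D ≤ r_j` because `p` was found by a sweep of at most this radius, and `r_j ≤ 2E ≤ 2D`
      -- because the witness is discovered too and `p` is farthest. The conditions on duration and
      -- waiting follow from `τ = oldest G + r_j`.
      end-phases : ∀ {total} → Farthest s G′ x → Phases τ x total →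
                   Phases t₀ s (dist s x + total) × r j ≤ dist s x + dist s x
      end-phases ((h , h∈ , rev) , farthest) ps with ∈-reveal⁻ vs G h∈ | witness
      ... | p , p∈ , refl | q , q∈ , r≤2E , 2a≤ with known-afterSweep p∈ rev
      ...   | refl , D≤r = extend (identity p) (identity q) τ
                (after-start p∈) (arrived p∈) (after-start q∈) (arrived q∈)
                (subst (dist s x + t₀ ≤_) (+-comm (r j) (oldest G)) (D≤r +≤ proj₁ started))
                (linear (D≤r +≤ 2a≤)
                  (solve 4 (λ D b a ρ → D :+ (b :+ b) :+ (ρ :+ (a :+ a :+ ρ))
                      := a :+ ρ :+ (a :+ ρ) :+ (D :+ (b :+ b))) refl
                    (dist s x) (born q) (oldest G) (r j)))
                (≤-trans D≤r r≤2E) ps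
              , ≤-trans r≤2E (E≤D +≤ E≤D)
        where
        after-start : ∀ {g} → g ∈ ghosts G → t₀ < born g
        after-start g∈ = <-≤-trans started (oldest-≤ G g∈)
        discovered : ∀ {y} → Is-just y → revealed (reveal vs q) ≡ y → dist s (place q) ≤ dist s x
        discovered {just y} _ eq = subst (λ v → dist s v ≤ dist s x) (proj₁ (known-afterSweep q∈ eq))
                                         (farthest (reveal vs q) y (∈-reveal⁺ vs G q∈ , eq))
        E≤D : dist s (place q) ≤ dist s x
        E≤D = discovered (All.lookup disc (∈-reveal⁺ vs G q∈)) refl

      -- The constant 21: `5 r_j` of budget, `5 r_j` for the last sweep and `D` for the move, with
      -- `10 r_j ≤ 20 D`.
      end-outcome : ∀ {l S} → Farthest s G′ x → Outcome τ x τ final S 0# → l ≤ τ →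
                    Outcome t₀ s l c ((at τ perform (w ∷ m ∷ [])) ∷ S) (sweepBudget j)
      end-outcome {S = S} far (outcome total ps cost≤ sorted complete) l≤τ =
        outcome (dist s x + total) (proj₁ (end-phases far ps))
          (linear (cost≤ +≤ sweep-cost +≤ move-cost +≤ 10r≤20D)
            (solve 6 (λ ρ D k k′ K T → con 5 :* ρ :+ (k :+ (k′ :+ con 0) :+ K)
                 :+ (con 21 :* T :+ (ρ :+ ρ :+ (ρ :+ ρ) :+ ρ) :+ (D :+ con 0) :+ con 10 :* (D :+ D))
               := con 21 :* (D :+ T) :+ (con 0 :+ K :+ k :+ k′ :+ con 10 :* ρ)) refl
              (r j) (dist s x) sweepCost moveCost (runCost final S) total))
          (l≤τ ∷ sorted) complete
        where
        10r≤20D : (10 ×′ 1#) * r j ≤ (10 ×′ 1#) * (dist s x + dist s x)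
        10r≤20D = subst₂ _≤_ (*-comm (r j) _) (*-comm (dist s x + dist s x) _) (times10 (proj₂ (end-phases far ps)))
          where
          times10 : ∀ {x y} → x ≤ y → x * (10 ×′ 1#) ≤ y * (10 ×′ 1#)
          times10 {x} {y} p = linear (p +≤ p +≤ p +≤ p +≤ p +≤ p +≤ p +≤ p +≤ p +≤ p)
            (solve 2 (λ x y → x :* con 10 :+ (y :+ y :+ y :+ y :+ y :+ y :+ y :+ y :+ y :+ y)
               := y :* con 10 :+ (x :+ x :+ x :+ x :+ x :+ x :+ x :+ x :+ x :+ x)) refl x y)

  idle-outcome  : ∀ {t s U c S} → idle s U ⇝ S → IdleInvariant t s U c → Outcome t s t c S 0#
  phase-outcome : ∀ {t s j G U c S l} → phase s j G U ⇝ S → PhaseInvariant t s j G U c → l ≤ sweepTime j G →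
                  Outcome t s l c S (sweepBudget j)

  idle-outcome {t} {c = c} halt inv = outcome 0# []
    (≤-reflexive (trans (+-identityʳ 0#) (sym (trans (*-comm (21 ×′ 1#) 0#) (zeroˡ (21 ×′ 1#)))))) [-]
    (λ q → [ (λ ()) , proj₁ ]′ (IdleInvariant.covered inv q))
  idle-outcome (resolved-epoch next eq run) inv = idle-outcome run (resolved-invariant inv next eq)
  idle-outcome {t} {c = c} {S} (start-phase next eq run) inv =
    forget (phase-outcome run pinv (≤-trans (proj₁ (PhaseInvariant.started pinv)) (x≤x+y _ (r-nonNeg 0))))
    where
    pinv = start-invariant inv next eq
    0≤budget : 0# ≤ sweepBudget 0
    0≤budget = let p = r-nonNeg 0 in linear (p +≤ p +≤ p +≤ p +≤ p)
      (solve 1 (λ ρ → con 0 :+ (ρ :+ ρ :+ ρ :+ ρ :+ ρ)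
          := con 5 :* ρ :+ (con 0 :+ con 0 :+ con 0 :+ con 0 :+ con 0)) refl (r 0))
    -- The phase is analysed with an initial allowance `5 r_0`, although nothing has been spent yet;
    -- dropping it only weakens the bound.
    forget : ∀ {s} → Outcome t s t c S (sweepBudget 0) → Outcome t s t c S 0#
    forget (outcome total ps cost≤ sorted complete) =
      outcome total ps (≤-trans (0≤budget +≤ ≤-refl) cost≤) sorted complete

  phase-outcome {j = j} {l = l} (epoch-in-phase {t = t′} next t≤sweep run) inv l≤ =
    phase-outcome run (epoch-invariant inv next t≤sweep)
      (subst (λ a → l ≤ a + r j) (sym (oldest-epoch {t = t′} inv)) l≤)
  phase-outcome {s = s} {j} (continue-phase none ¬all run) inv l≤ =
    continue-outcome (phase-outcome run (continue-invariant ¬all) τ-grows) l≤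
    where open Sweep inv none (sweep s (r j)) (sweep-end {s} (r-nonNeg j)) (sweep-len {s} (r-nonNeg j))
                     (sweep-within {s} (r-nonNeg j)) (sweep-covers {s} (r-nonNeg j))
  phase-outcome {s = s} {j} (end-phase {x = x} none all far run) inv l≤ =
    end-outcome far (idle-outcome run end-invariant) l≤
    where
    open Sweep inv none (sweep s (r j)) (sweep-end {s} (r-nonNeg j)) (sweep-len {s} (r-nonNeg j))
               (sweep-within {s} (r-nonNeg j)) (sweep-covers {s} (r-nonNeg j))
    open Move all x (monotone s x) (end-monotone s x) (len-monotone s x)

-- Existence of a complete run.

module ExplorationRuns (R : RealNumbers) (X : FiniteSubset R) (s₀ : FiniteSubset.Site X) (I : Input R X)
                       (radii : DoublingRadii R X) where
  open RealNumbers R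
  open FiniteSubset X
  open Geometry R X
  open DoublingRadii radii
  open OrderedFieldProperties R
  open GeometryProperties R X
  open Input I
  open Service R X s₀ I
  open ExplorationBound R X s₀ I radii
  open Exploration r
  open Ghost
  open Data.List.Extrema totalOrder using
    (argmin-sel; min≤⊤; min≤xs; argmax-all; f[⊥]≤f[argmax]; f[xs]≤f[argmax])

  Truthful : List⁺ Ghost → Set
  Truthful G = ∀ {g x} → g ∈ ghosts G → revealed g ≡ just x → x ≡ place g

  next-epoch : ∀ u us → ∃[ t ] NextEpoch t (u ∷ us)
  next-epoch u us = min (arrival u) (map arrival us) , attained ,
    (min≤⊤ (arrival u) (map arrival us) ∷
     All.tabulate (λ q∈ → All.lookup (min≤xs (arrival u) (map arrival us)) (∈-map⁺ arrival q∈)))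
    where
    attained : ∃[ q ] q ∈ u ∷ us × arrival q ≡ min (arrival u) (map arrival us)
    attained with argmin-sel id (arrival u) (map arrival us)
    ... | inj₁ eq   = u , here refl , sym eq
    ... | inj₂ min∈ with ∈-map⁻ arrival min∈
    ...   | q , q∈ , eq = q , there q∈ , sym eq

  later-shorter : ∀ {t U} → NextEpoch t U → length (later t U) ℕ.< length U
  later-shorter {U = U} ((q , q∈U , a≡t) , _) = filter-notAll _ U (lose q∈U (λ a≢t → a≢t a≡t))

  reveal-truthful : ∀ vs G → Truthful G → Truthful (List⁺.map (reveal vs) G)
  reveal-truthful vs G truth h∈ rev =
    let (g , g∈ , eq) = ∈-reveal⁻ vs G h∈
    in [ (λ (x≡ , _) → trans x≡ (cong location (trans (sym (reveal-identity vs g)) (cong identity (sym eq)))))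
       , (λ rev′ → trans (truth g∈ rev′) (cong location (trans (sym (reveal-identity vs g)) (cong identity (sym eq)))))
       ]′ (reveal-known vs g (trans (cong revealed (sym eq)) rev))

  reveal-all : ∀ vs G → (∀ v → v ∈ vs) → AllDiscovered (List⁺.map (reveal vs) G)
  reveal-all vs G covers = All.tabulate λ h∈ →
    let (g , _ , eq) = ∈-reveal⁻ vs G h∈
    in subst (Is-just ∘ revealed) (sym eq) (reveal-visited vs g (covers (place g)))

  farthest-exists : ∀ s G → Truthful G → AllDiscovered G → ∃[ x ] Farthest s G x
  farthest-exists s (g ∷ gs) truth disc = place p , (p , p∈ , revealed-place p∈ (All.lookup disc p∈)) , farthest
    where
    p : Ghost
    p = argmax (dist s ∘ place) g gs
    p∈ : p ∈ g ∷ gs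
    p∈ = argmax-all (dist s ∘ place) {P = _∈ g ∷ gs} (here refl) (All.tabulate there)
    revealed-place : ∀ {h} → h ∈ g ∷ gs → Is-just (revealed h) → revealed h ≡ just (place h)
    revealed-place {ghost _ (just x)} h∈ _ = cong just (truth h∈ refl)
    farther : ∀ {h} → h ∈ g ∷ gs → dist s (place h) ≤ dist s (place p)
    farther (here refl) = f[⊥]≤f[argmax] {f = dist s ∘ place} g gs
    farther (there h∈)  = All.lookup (f[xs]≤f[argmax] {f = dist s ∘ place} g gs) h∈
    farthest : ∀ h y → h DiscoveredIn (g ∷ gs) At y → dist s y ≤ dist s (place p)
    farthest h y (h∈ , rev) = subst (λ v → dist s v ≤ dist s (place p)) (sym (truth h∈ rev)) (farther h∈)

  new-hidden : ∀ {s t U g} → g ∈ newGhosts s t U → revealed g ≡ nothing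
  new-hidden {s} {t} {U} g∈ = proj₁ (proj₁ (∈-newGhosts⁻ {s} {t} {U} g∈))

  hidden-unknown : ∀ {g} {x : Site} → revealed g ≡ nothing → revealed g ≢ just x
  hidden-unknown hid rev with trans (sym hid) rev
  ... | ()

  new-truthful : ∀ {s t U g gs} → newGhosts s t U ≡ g ∷ gs → Truthful (g ∷ gs)
  new-truthful {s} {t} {U} eq {h} h∈ rev =
    contradiction rev (hidden-unknown {h} (new-hidden {s} {t} {U} (subst (h ∈_) (sym eq) h∈)))

  extended-truthful : ∀ {s t U} G → Truthful G → Truthful (G ⁺++ newGhosts s t U)
  extended-truthful {s} {t} {U} G truth {h} h∈ rev =
    [ (λ h∈G → truth h∈G rev)
    , (λ h∈N → contradiction rev (hidden-unknown {h} (new-hidden {s} {t} {U} h∈N)))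
    ]′ (∈-++⁻ (ghosts G) h∈)

  -- The recursive calls are arguments, guarded by an equation for `k`, so that the descent in `k`
  -- remains visible at the call in `swept-run`. With `k ≡ 0`, `last` rules out a further sweep.
  sweep-run : ∀ {s j G U} k → All (λ q → sweepTime j G < arrival q) U → Truthful (afterSweep s j G) →
    (k ≡ 0 → AllDiscovered (afterSweep s j G)) →
    (∀ x → ∃[ S ] idle x U ⇝ S) →
    (∀ k′ → k ≡ suc k′ → ∃[ S ] phase s (suc j) (afterSweep s j G) U ⇝ S) →
    ∃[ S ] phase s j G U ⇝ S
  sweep-run {s} {j} {G} k none truth last idle-run phase-run =
    decide (All.all? discovered? (ghosts (afterSweep s j G)))
    where
    decide : Dec (AllDiscovered (afterSweep s j G)) → _
    decide (yes disc) =
      let (x , far) = farthest-exists s (afterSweep s j G) truth disc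
          (_ , run) = idle-run x
      in _ , end-phase none disc far run
    decide (no ¬disc) = go k refl
      where
      go : ∀ k″ → k ≡ k″ → _
      go zero    eq = contradiction (last eq) ¬disc
      go (suc k′) eq = let (_ , run) = phase-run k′ eq in _ , continue-phase none ¬disc run

  -- n bounds the number of requests to come; after k further sweeps the radius
  -- exceeds the diameter.
  idle-run  : ∀ n s U → length U ℕ.≤ n → ∃[ S ] idle s U ⇝ S
  phase-run : ∀ n k s j G U → length U ℕ.≤ n → k ℕ.+ j ≡ lastIndex → Truthful G → ∃[ S ] phase s j G U ⇝ S
  swept-run : ∀ n k s j G U → length U ℕ.≤ n → k ℕ.+ j ≡ lastIndex → Truthful G →
              All (λ q → sweepTime j G < arrival q) U → ∃[ S ] phase s j G U ⇝ S

  idle-run n       s []       _    = [] , halt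
  idle-run (suc n) s (u ∷ us) len≤ = go (newGhosts s t (u ∷ us)) refl
    where
    t = proj₁ (next-epoch u us)
    next = proj₂ (next-epoch u us)
    shorter : length (later t (u ∷ us)) ℕ.≤ n
    shorter = ℕ.s≤s⁻¹ (ℕ.≤-trans (later-shorter next) len≤)
    go : ∀ hs → newGhosts s t (u ∷ us) ≡ hs → ∃[ S ] idle s (u ∷ us) ⇝ S
    go []       eq = let (S , run) = idle-run n s (later t (u ∷ us)) shorter in S , resolved-epoch next eq run
    go (g ∷ gs) eq =
      let (S , run) = phase-run n lastIndex s 0 (g ∷ gs) (later t (u ∷ us)) shorter (ℕ.+-identityʳ lastIndex)
                        (new-truthful eq)
      in S , start-phase next eq run

  phase-run n       k s j G []       len≤ k+j≡N truth = swept-run n k s j G [] len≤ k+j≡N truth []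
  phase-run n₁@(suc n) k s j G (u ∷ us) len≤ k+j≡N truth =
    let (t , next) = next-epoch u us in
    [ (λ t≤sweep →
        let (S , run) = phase-run n k s j (G ⁺++ newGhosts s t (u ∷ us)) (later t (u ∷ us))
                          (ℕ.s≤s⁻¹ (ℕ.≤-trans (later-shorter next) len≤)) k+j≡N (extended-truthful G truth)
        in S , epoch-in-phase next t≤sweep run)
    , (λ t≰sweep → swept-run n₁ k s j G (u ∷ us) len≤ k+j≡N truth
        (All.map (<-≤-trans (≰⇒> t≰sweep)) (proj₂ next)))
    ]′ (toSum (t ≤? sweepTime j G))

  -- Here `j` equals `lastIndex`, so the sweep reaches every site and the phase ends.
  swept-run n zero s j G U len≤ j≡N truth none =
    sweep-run zero none (reveal-truthful _ G truth)
      (λ _ → reveal-all _ G (λ v → sweep-covers {s} (r-nonNeg j) (subst (λ i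
          → dist s v ≤ r i) (sym j≡N) (r-last s v))))
      (λ x → idle-run n x U len≤) (λ _ ())
  swept-run n (suc k) s j G U len≤ k+j≡N truth none =
    sweep-run (suc k) none (reveal-truthful _ G truth) (λ ())
      (λ x → idle-run n x U len≤)
      (λ { _ refl → phase-run n k s (suc j) (afterSweep s j G) U len≤ (trans (ℕ.+-suc k j) k+j≡N) (reveal-truthful _ G truth) })

-- The ratio against every feasible schedule and against the infimum.

module Competitive (R : RealNumbers) (X : FiniteSubset R) (s₀ : FiniteSubset.Site X) (I : Input R X)
                   (radii : DoublingRadii R X) where
  open RealNumbers R
  open Geometry R X
  open DoublingRadii radii
  open OrderedFieldProperties R
  open GeometryProperties R X
  open Input I
  open Service R X s₀ I
  open ServiceProperties R X s₀ I
  open OfflineBound R X s₀ I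
  open Exploration r using (idle; _⇝_)
  open NumeralMult semiring using (×ᵤ≈×) renaming (_×_ to _×′_)
  open ExplorationBound R X s₀ I radii
    using (IdleInvariant; Outcome; outcome; idle-outcome)
  open ExplorationRuns R X s₀ I radii using (idle-run)

  runCost-nonNeg : ∀ c S → 0# ≤ runCost c S
  runCost-nonNeg c []                      = ≤-refl
  runCost-nonNeg c ((at t perform ws) ∷ S) =
    0≤x+y (≤-trans (len-nonNeg (Server.position c) (concat ws)) (walks-len t (await t c) ws)) (runCost-nonNeg _ S)

  initial-outcome : ∀ {t S} → t < 0# → idle s₀ requests ⇝ S → Outcome t s₀ t initial S 0#
  initial-outcome t<0 run = idle-outcome run record
    { anchored = refl
    ; upcoming = λ {u} _ → <-≤-trans t<0 (arrival-nonNeg u)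
    ; covered  = λ q → inj₁ (∈-allFin q)
    }

  -1<0 : - 1# < 0#
  -1<0 = ≰⇒> λ 0≤-1 → <⇒≱ 0<1 (subst₂ _≤_ (+-identityˡ 1#) (-‿inverseˡ 1#) (0≤-1 +≤ ≤-refl {1#}))

  -- Schedules may act before time 0.
  early : ∀ S → Linked _≤_ (map Action.time S) → ∃[ t ] t < 0# × Sorted t S
  early []      _  = - 1# , -1<0 , [-]
  early (a ∷ S) st with ≤-total (- 1#) (Action.time a)
  ... | inj₁ -1≤a = - 1# , -1<0 , -1≤a ∷ st
  ... | inj₂ a≤-1 = Action.time a , ≤-<-trans a≤-1 -1<0 , ≤-refl ∷ st

  run-feasible : ∀ {S} → idle s₀ requests ⇝ S → Feasible S
  run-feasible run with initial-outcome -1<0 run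
  ... | outcome _ _ _ sorted complete = Linked.tail sorted , complete

  84-competitive : ∀ {S} → idle s₀ requests ⇝ S → ∀ T → Feasible T → cost S ≤ fromℕ 84 * cost T
  -- The chosen `t` precedes all arrivals and is no later than any action of `T`; the run is
  -- analysed from the same `t` because `Phases` is indexed by it.
  84-competitive {S} run T (linked , complete) with early T linked
  ... | t , t<0 , sorted with initial-outcome t<0 run
  ...   | outcome total phases cost≤ _ _ = ≤-trans (≤-trans (≤-reflexive (sym (+-identityˡ (cost S)))) cost≤)
          (subst₂ _≤_ (*-comm total (21 ×′ 1#)) eq (times21 total≤))
    where
    total≤ : total + 0# ≤ 0# + quadruple (cost T)
    total≤ = ≤-trans (≤-refl +≤ 0≤4age)
      (offline-bound initial T phases (near near0) sorted (λ ()) complete)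
      where
      0≤4age : 0# ≤ quadruple (age initial t)
      0≤4age = let p = age-nonNeg initial t in 0≤x+y (0≤x+y p p) (0≤x+y p p)
      near0 : dist s₀ s₀ + dist s₀ s₀ ≤ 0#
      near0 = ≤-reflexive (trans (cong₂ _+_ (dist-refl s₀) (dist-refl s₀)) (+-identityˡ 0#))
    times21 : ∀ {x y} → x + 0# ≤ 0# + y → x * (21 ×′ 1#) ≤ y * (21 ×′ 1#)
    times21 {x} {y} p = *-monoʳ-≤ (subst (0# ≤_) (×ᵤ≈× 21 1#) (fromℕ-nonNeg 21))
      (subst₂ _≤_ (+-identityʳ x) (+-identityˡ y) p)
    eq : quadruple (cost T) * (21 ×′ 1#) ≡ fromℕ 84 * cost T
    eq = trans (solve 1 (λ x → (x :+ x :+ (x :+ x)) :* con 21 := con 84 :* x) refl (cost T))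
      (cong (_* cost T) (sym (×ᵤ≈× 84 1#)))

  optimum-and-ratio : ∃[ opt ] IsOPT opt
              × (∃[ S ] idle s₀ requests ⇝ S)
              × (∀ S → idle s₀ requests ⇝ S → Feasible S × cost S ≤ fromℕ 84 * opt)
  optimum-and-ratio = opt , isOpt , some-run , λ S run → run-feasible run , bound S run
    where
    some-run : ∃[ S ] idle s₀ requests ⇝ S
    some-run = idle-run (length requests) s₀ requests ℕ.≤-refl

    Cost : ℝ → Set
    Cost x = ∃[ S ] Feasible S × cost S ≡ x

    -- A run of the algorithm itself shows that the set of feasible costs is inhabited.
    infimum : ∃[ m ] IsInfimum Cost m
    infimum = complete Cost (_ , proj₁ some-run , run-feasible (proj₂ some-run) , refl)
      (0# , λ { _ (S , _ , refl) → runCost-nonNeg initial S })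
    opt = proj₁ infimum
    isOpt = proj₂ infimum

    -- The infimum need not be attained, so the comparison with each `T` is divided by 84:
    -- `cost S * d`, with `d` the inverse of 84, is then a lower bound of all feasible costs and
    -- hence at most `opt`.
    bound : ∀ S → idle s₀ requests ⇝ S → cost S ≤ fromℕ 84 * opt
    bound S run with positive-inverse (fromℕ-pos 83)
    ... | d , 0≤d , 84d≡1 = subst₂ _≤_ (scale (cost S)) (*-comm opt (fromℕ 84))
          (*-monoʳ-≤ (fromℕ-nonNeg 84) (proj₂ isOpt (cost S * d) lower))
      where
      scale : ∀ x → x * d * fromℕ 84 ≡ x
      scale x = trans (*-assoc x d (fromℕ 84)) (trans (cong (x *_) (trans (*-comm d (fromℕ 84)) 84d≡1))
        (trans (*-comm x 1#) (*-identityˡ x)))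
      lower : IsLowerBound Cost (cost S * d)
      lower _ (T , feasible , refl) = subst (cost S * d ≤_)
        (trans (cong (_* d) (*-comm (fromℕ 84) (cost T))) (trans (*-assoc (cost T) (fromℕ 84) d)
          (trans (cong (cost T *_) 84d≡1) (trans (*-comm (cost T) 1#) (*-identityˡ (cost T))))))
        (*-monoʳ-≤ 0≤d (84-competitive run T feasible))

theorem7p5 : (R : RealNumbers) (X : FiniteSubset R) (s₀ : FiniteSubset.Site X) (I : Input R X) →
    let open RealNumbers R
        open Service R X s₀ I
    in ∃[ opt ] IsOPT opt
              × (∃[ S ] AnchorExploration S)
              × (∀ S → AnchorExploration S → Feasible S × cost S ≤ fromℕ 84 * opt)
theorem7p5 R X s₀ I = Competitive.optimum-and-ratio R X s₀ I (dyadicRadii R X)
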